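{- Let $\mathcal{X}_{P_v}(z):=\sum_{n\ge 1} X_{P_{n,v}}\, z^{n+1}$ be the generating function for the chromatic symmetric functions of the paths twinned at a leaf. Then $$\frac12\,\mathcal{X}_{P_v}(z)=K(z)\frac{G_{\ge 3}(z)}{D(z)}+e_1z\,G(z)\frac{G_{\ge 3}(z)}{D(z)}+e_2z^2+\sum_{i\ge 3} i\,e_i z^i+e_1z\,G_{\ge 3}(z).$$ In particular $X_{P_{n,v}}$ is $e$-positive (for all $n\ge 1$), and the initial values are $X_{P_{1,v}}=2e_2$, $X_{P_{2,v}}=2(3e_3)$, $X_{P_{3,v}}=2(4e_4+2e_1e_3)$, $X_{P_{4,v}}=2(4e_2e_3+3e_1e_4+5e_5)$. Moreover, in terms of the path generating function $\mathcal{X}_P(z)$, one has the $e$-positive expression $$\frac12\,\mathcal{X}_{P_v}(z)=\mathcal{X}_P(z)\,G_{\ge 3}(z)+\sum_{i\ge 2} e_i z^i .$$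
   Context: The chromatic symmetric function of a finite simple graph $H=(V,E)$ is $X_H=\sum_\kappa\prod_{u\in V}x_{\kappa(u)}$, the sum over all proper colorings $\kappa:V\to\mathbb{Z}_{>0}$. $P_n$ is the path on $n$ vertices ($X_{P_0}=1$). The twin $H_v$ of a graph $H$ at a vertex $v$ is obtained by adding a new vertex $v'$ joined to $v$ and to all neighbors of $v$. $P_{n,v}$ denotes $P_n$ twinned at $v$, where $v$ is an end vertex (leaf) of $P_n$ (for $n=1$, $v$ is the only vertex). $e_i$ is the $i$-th elementary symmetric function; a symmetric function is $e$-positive if its expansion in the basis of elementary symmetric functions $e_\lambda$ has nonnegative coefficients, and a power series in $z$ over symmetric functions is $e$-positive if each of its coefficients is. Notation: $\mathcal{X}_P(z)=\sum_{n\ge 0}X_{P_n}z^n$, $K(z)=\sum_{i\ge 2} i e_i z^i$, $G(z)=\sum_{i\ge 2}(i-1)e_iz^i$, $G_{\ge k}(z)=\sum_{i\ge k}(i-1)e_iz^i$, $D(z)=1-G(z)$. -}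

module Defs where

open import Data.Nat.Base as ℕ using (ℕ; zero; suc; _∸_; NonZero)
open import Data.Nat.ListAction using (sum)
import Data.Nat.Properties as ℕ
open import Data.Integer.Base using (+_)
open import Data.Rational.Base as ℚ using (ℚ; 0ℚ; 1ℚ; _/_)
import Data.Rational.Properties as ℚ
open import Data.Bool.Base using (true; false; if_then_else_)
open import Data.Empty using (⊥)
open import Data.Fin.Base as Fin using (Fin; zero; suc; toℕ)
import Data.Fin.Properties as Fin
open import Data.List.Base as List using (List; []; _∷_; _++_; map; foldr; filter; length; upTo; applyUpTo; allFin; cartesianProductWith)
open import Data.List.Relation.Unary.All as All using (All)
open import Data.List.Relation.Unary.Linked using (Linked)
open import Data.List.Relation.Unary.Unique.Propositional using (Unique)
open import Data.Product.Base using (Σ-syntax; _×_; _,_; proj₁; proj₂)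
open import Data.Sum.Base as Sum using (_⊎_; inj₁; inj₂)
open import Data.Vec.Base as Vec using (Vec; []; _∷_)
open import Function.Base using (_∘_; id)
open import Relation.Nullary.Decidable using (Dec; yes; no; does; ¬?; _×-dec_; _⊎-dec_; _→-dec_)
open import Relation.Nullary.Negation using (¬_)
open import Relation.Binary.PropositionalEquality

record Graph (n : ℕ) : Set₁ where
  field
    Adj        : Fin n → Fin n → Set
    adj?       : ∀ u w → Dec (Adj u w)
    adj-sym    : ∀ {u w} → Adj u w → Adj w u
    adj-irrefl : ∀ {u} → ¬ Adj u u

path : (n : ℕ) → Graph n
path n = record
  { Adj        = λ u w → suc (toℕ u) ≡ toℕ w ⊎ suc (toℕ w) ≡ toℕ u
  ; adj?       = λ u w → (suc (toℕ u) ℕ.≟ toℕ w) ⊎-dec (suc (toℕ w) ℕ.≟ toℕ u)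
  ; adj-sym    = Sum.swap
  ; adj-irrefl = λ { (inj₁ p) → ℕ.1+n≢n p ; (inj₂ p) → ℕ.1+n≢n p }
  }

IsEndVertex : ∀ {n} → Fin n → Set
IsEndVertex {n} v = toℕ v ≡ 0 ⊎ suc (toℕ v) ≡ n

-- In the twin, zero is the new vertex v′ and suc u is the old vertex u.
module _ {n : ℕ} (H : Graph n) (v : Fin n) where
  open Graph H

  TwinAdj : Fin (suc n) → Fin (suc n) → Set
  TwinAdj zero    zero    = ⊥
  TwinAdj zero    (suc w) = w ≡ v ⊎ Adj v w
  TwinAdj (suc u) zero    = u ≡ v ⊎ Adj v u
  TwinAdj (suc u) (suc w) = Adj u w

  twinAdj? : ∀ u w → Dec (TwinAdj u w)
  twinAdj? zero    zero    = no λ ()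
  twinAdj? zero    (suc w) = (w Fin.≟ v) ⊎-dec adj? v w
  twinAdj? (suc u) zero    = (u Fin.≟ v) ⊎-dec adj? v u
  twinAdj? (suc u) (suc w) = adj? u w

  twinAdj-sym : ∀ u w → TwinAdj u w → TwinAdj w u
  twinAdj-sym zero    (suc w) p = p
  twinAdj-sym (suc u) zero    p = p
  twinAdj-sym (suc u) (suc w) p = adj-sym p

  twinAdj-irrefl : ∀ u → ¬ TwinAdj u u
  twinAdj-irrefl (suc u) p = adj-irrefl p

  twin : Graph (suc n)
  twin = record
    { Adj        = TwinAdj
    ; adj?       = twinAdj?
    ; adj-sym    = λ {u} {w} → twinAdj-sym u w
    ; adj-irrefl = λ {u} → twinAdj-irrefl u
    }

-- f (a₁ ∷ … ∷ aₖ ∷ []) is the coefficient of x₁^a₁ ⋯ xₖ^aₖ.  The values of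
-- f on lists of length k form the series f(x₁,…,xₖ,0,0,…), so a series in
-- infinitely many variables is presented by its restrictions to finitely
-- many variables.  Equality and the ring operations are those of the
-- restrictions.  Symmetric functions live in this larger ring.
Series : Set
Series = List ℕ → ℚ

infix 4 _≈ˢ_
_≈ˢ_ : Series → Series → Set
f ≈ˢ g = ∀ α → f α ≡ g α

sumℚ : ∀ {A : Set} → List A → (A → ℚ) → ℚ
sumℚ xs f = foldr (λ x s → f x ℚ.+ s) 0ℚ xs

-- All pairs (β , γ) of exponent lists with β + γ = α.
splits : List ℕ → List (List ℕ × List ℕ)
splits []      = ([] , []) ∷ []
splits (a ∷ α) =
  cartesianProductWith (λ i (β , γ) → i ∷ β , (a ∸ i) ∷ γ) (upTo (suc a)) (splits α)

0ˢ 1ˢ : Series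
0ˢ α = 0ℚ
1ˢ α = if does (All.all? (ℕ._≟ 0) α) then 1ℚ else 0ℚ

infixl 6 _+ˢ_ _-ˢ_
infixl 7 _*ˢ_
infixr 8 _•ˢ_ _⋆_

_+ˢ_ _-ˢ_ _*ˢ_ : Series → Series → Series
(f +ˢ g) α = f α ℚ.+ g α
(f -ˢ g) α = f α ℚ.- g α
(f *ˢ g) α = sumℚ (splits α) λ (β , γ) → f β ℚ.* g γ

_•ˢ_ : ℚ → Series → Series
(c •ˢ f) α = c ℚ.* f α

_⋆_ : ℕ → Series → Series
n ⋆ f = (+ n / 1) •ˢ f

sumˢ : ∀ {A : Set} → List A → (A → Series) → Series
sumˢ xs f = foldr (λ x s → f x +ˢ s) 0ˢ xs

-- The monomials of eᵢ are the squarefree ones of degree i.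
e : ℕ → Series
e i α = if does (All.all? (ℕ._≤? 1) α ×-dec (sum α ℕ.≟ i)) then 1ℚ else 0ℚ

e[_] : List ℕ → Series
e[ λs ] = foldr (λ i f → e i *ˢ f) 1ˢ λs

record IsPartition (λs : List ℕ) : Set where
  field
    positive   : All (0 ℕ.<_) λs
    decreasing : Linked ℕ._≥_ λs

-- A pair (c , λ) in terms is a term c e_λ; each partition occurs at most
-- once, so c is the coefficient of e_λ.
record EExpansion (f : Series) : Set where
  field
    terms      : List (ℚ × List ℕ)
    partitions : All (IsPartition ∘ proj₂) terms
    distinct   : Unique (map proj₂ terms)
    expands    : f ≈ˢ sumˢ terms λ (c , λs) → c •ˢ e[ λs ]

EPositive : Series → Set
EPositive f = Σ[ E ∈ EExpansion f ] All ((0ℚ ℚ.≤_) ∘ proj₁) (EExpansion.terms E)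

Colouring : ℕ → ℕ → Set
Colouring n k = Vec (Fin k) n

colourings : (n k : ℕ) → List (Colouring n k)
colourings zero    k = [] ∷ []
colourings (suc n) k = cartesianProductWith _∷_ (allFin k) (colourings n k)

module _ {n : ℕ} (H : Graph n) where
  open Graph H

  Proper : ∀ {k} → Colouring n k → Set
  Proper κ = ∀ u w → Adj u w → Vec.lookup κ u ≢ Vec.lookup κ w

  proper? : ∀ {k} (κ : Colouring n k) → Dec (Proper κ)
  proper? κ = Fin.all? λ u → Fin.all? λ w →
    adj? u w →-dec ¬? (Vec.lookup κ u Fin.≟ Vec.lookup κ w)

-- The monomial ∏ᵤ x_κ(u) has exponent list α.
HasContent : ∀ {n} (α : List ℕ) → Colouring n (length α) → Set
HasContent α κ = ∀ c → Vec.count (c Fin.≟_) κ ≡ List.lookup α c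

hasContent? : ∀ {n} (α : List ℕ) (κ : Colouring n (length α)) → Dec (HasContent α κ)
hasContent? α κ = Fin.all? λ c → Vec.count (c Fin.≟_) κ ℕ.≟ List.lookup α c

-- The coefficient of x^α in X_H is the number of proper colourings with
-- ∏ᵤ x_κ(u) = x^α; these only use the colours 1, …, length α.
X : ∀ {n} → Graph n → Series
X {n} H α =
  + length (filter (λ κ → proper? H κ ×-dec hasContent? α κ) (colourings n (length α))) / 1

ZSeries : Set
ZSeries = ℕ → Series

infix 4 _≈ᶻ_
_≈ᶻ_ : ZSeries → ZSeries → Set
F ≈ᶻ H = ∀ n → F n ≈ˢ H n

EPositiveᶻ : ZSeries → Set
EPositiveᶻ F = ∀ n → EPositive (F n)

infixl 6 _+ᶻ_ _-ᶻ_
infixl 7 _*ᶻ_ _/ᶻ_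
infixr 8 _•ᶻ_ _z^_

_+ᶻ_ _-ᶻ_ _*ᶻ_ : ZSeries → ZSeries → ZSeries
(F +ᶻ H) n = F n +ˢ H n
(F -ᶻ H) n = F n -ˢ H n
(F *ᶻ H) n = sumˢ (upTo (suc n)) λ i → F i *ˢ H (n ∸ i)

_•ᶻ_ : ℚ → ZSeries → ZSeries
(c •ᶻ F) n = c •ˢ F n

_z^_ : Series → ℕ → ZSeries
(f z^ k) n = if does (n ℕ.≟ k) then f else 0ˢ

1ᶻ : ZSeries
1ᶻ = 1ˢ z^ 0

-- ∑_{i ≥ k} fᵢ zⁱ
∑≥ : ℕ → (ℕ → Series) → ZSeries
∑≥ k f n = if does (k ℕ.≤? n) then f n else 0ˢ

-- The coefficients b_{n-1}, …, b₀ of 1/F for F with constant term 1, by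
-- bₙ = [n = 0] - ∑_{i < n} F_{i+1} b_{n-1-i}; see *ᶻ-inverse.
recips : ZSeries → (n : ℕ) → Vec Series n
recips F zero    = []
recips F (suc n) =
  (1ᶻ n -ˢ sumˢ (allFin n) (λ i → F (suc (toℕ i)) *ˢ Vec.lookup (recips F n) i)) ∷ recips F n

recip : ZSeries → ZSeries
recip F n = Vec.head (recips F (suc n))

_/ᶻ_ : ZSeries → ZSeries → ZSeries
F /ᶻ H = F *ᶻ recip H

K : ZSeries
K = ∑≥ 2 λ i → i ⋆ e i

G≥ : ℕ → ZSeries
G≥ k = ∑≥ k λ i → (i ∸ 1) ⋆ e i

G : ZSeries
G = G≥ 2

D : ZSeries
D = 1ᶻ -ᶻ G

𝒳-P : ZSeries
𝒳-P n = X (path n)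

-- ∑_{n ≥ 1} X_{P_{n,v}} z^{n+1}, where v n is the vertex of Pₙ that is twinned.
𝒳-Pᵥ : ((n : ℕ) .{{_ : NonZero n}} → Fin n) → ZSeries
𝒳-Pᵥ v zero          = 0ˢ
𝒳-Pᵥ v (suc zero)    = 0ˢ
𝒳-Pᵥ v (suc (suc m)) = X (twin (path (suc m)) (v (suc m)))

sumℚ-++ : ∀ {A : Set} (xs ys : List A) f → sumℚ (xs ++ ys) f ≡ sumℚ xs f ℚ.+ sumℚ ys f
sumℚ-++ []       ys f = sym (ℚ.+-identityˡ _)
sumℚ-++ (x ∷ xs) ys f =
  trans (cong (f x ℚ.+_) (sumℚ-++ xs ys f)) (sym (ℚ.+-assoc (f x) _ _))

sumℚ-map : ∀ {A B : Set} (g : A → B) xs f → sumℚ (map g xs) f ≡ sumℚ xs (f ∘ g)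
sumℚ-map g []       f = refl
sumℚ-map g (x ∷ xs) f = cong (f (g x) ℚ.+_) (sumℚ-map g xs f)

sumℚ-cong : ∀ {A : Set} (xs : List A) {f g : A → ℚ} → (∀ x → f x ≡ g x) → sumℚ xs f ≡ sumℚ xs g
sumℚ-cong []       p = refl
sumℚ-cong (x ∷ xs) p = cong₂ ℚ._+_ (p x) (sumℚ-cong xs p)

sumℚ-zero : ∀ {A : Set} (xs : List A) {f : A → ℚ} → (∀ x → f x ≡ 0ℚ) → sumℚ xs f ≡ 0ℚ
sumℚ-zero []       p = refl
sumℚ-zero (x ∷ xs) p = trans (cong₂ ℚ._+_ (p x) (sumℚ-zero xs p)) (ℚ.+-identityˡ 0ℚ)

*ˢ-identityˡ : ∀ f → 1ˢ *ˢ f ≈ˢ f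
*ˢ-identityˡ f [] = trans (ℚ.+-identityʳ _) (ℚ.*-identityˡ (f []))
*ˢ-identityˡ f (a ∷ α) = begin
  sumℚ (map (h 0) ys ++ cartesianProductWith h js ys) t
    ≡⟨ sumℚ-++ (map (h 0) ys) _ t ⟩
  sumℚ (map (h 0) ys) t ℚ.+ sumℚ (cartesianProductWith h js ys) t
    ≡⟨ cong₂ ℚ._+_ (sumℚ-map (h 0) ys t) (higher id a) ⟩
  (1ˢ *ˢ (f ∘ (a ∷_))) α ℚ.+ 0ℚ
    ≡⟨ ℚ.+-identityʳ _ ⟩
  (1ˢ *ˢ (f ∘ (a ∷_))) α
    ≡⟨ *ˢ-identityˡ (f ∘ (a ∷_)) α ⟩
  f (a ∷ α) ∎
  where
  open ≡-Reasoning
  ys = splits α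
  js = applyUpTo suc a
  h : ℕ → List ℕ × List ℕ → List ℕ × List ℕ
  h i (β , γ) = i ∷ β , (a ∸ i) ∷ γ
  t : List ℕ × List ℕ → ℚ
  t (β , γ) = 1ˢ β ℚ.* f γ
  higher : ∀ (s : ℕ → ℕ) m → sumℚ (cartesianProductWith h (applyUpTo (suc ∘ s) m) ys) t ≡ 0ℚ
  higher s zero    = refl
  higher s (suc m) = trans (sumℚ-++ (map (h (suc (s 0))) ys) _ t)
    (trans (cong₂ ℚ._+_
             (trans (sumℚ-map (h (suc (s 0))) ys t) (sumℚ-zero ys λ (β , γ) → ℚ.*-zeroˡ (f ((a ∸ suc (s 0)) ∷ γ))))
             (higher (s ∘ suc) m))
           (ℚ.+-identityˡ 0ℚ))

lookup-recips : ∀ F n i → Vec.lookup (recips F n) i ≡ recip F (n ∸ suc (toℕ i))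
lookup-recips F (suc n) zero    = refl
lookup-recips F (suc n) (suc i) = lookup-recips F n i

sum-tabulate : ∀ {A : Set} n (g : Fin n → A) (s : ℕ → ℕ) (h : A → Series) (k : ℕ → Series) →
  (∀ i → h (g i) ≡ k (s (toℕ i))) → sumˢ (List.tabulate g) h ≡ sumˢ (applyUpTo s n) k
sum-tabulate zero    g s h k p = refl
sum-tabulate (suc n) g s h k p =
  cong₂ _+ˢ_ (p zero) (sum-tabulate n (g ∘ suc) (s ∘ suc) h k (p ∘ suc))

*ᶻ-inverse : ∀ F → F 0 ≈ˢ 1ˢ → F *ᶻ recip F ≈ᶻ 1ᶻ
*ᶻ-inverse F F₀ n α = begin
  (F 0 *ˢ recip F n) α ℚ.+ S α
    ≡⟨ cong (ℚ._+ S α) (sumℚ-cong (splits α) λ (β , γ) → cong (ℚ._* recip F n γ) (F₀ β)) ⟩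
  (1ˢ *ˢ recip F n) α ℚ.+ S α
    ≡⟨ cong (ℚ._+ S α) (*ˢ-identityˡ (recip F n) α) ⟩
  (1ᶻ n α ℚ.- T α) ℚ.+ S α
    ≡⟨ cong (λ U → (1ᶻ n α ℚ.- U α) ℚ.+ S α) T≡S ⟩
  (1ᶻ n α ℚ.- S α) ℚ.+ S α
    ≡⟨ ℚ.+-assoc (1ᶻ n α) (ℚ.- S α) (S α) ⟩
  1ᶻ n α ℚ.+ (ℚ.- S α ℚ.+ S α)
    ≡⟨ cong (1ᶻ n α ℚ.+_) (ℚ.+-inverseˡ (S α)) ⟩
  1ᶻ n α ℚ.+ 0ℚ
    ≡⟨ ℚ.+-identityʳ _ ⟩
  1ᶻ n α ∎
  where
  open ≡-Reasoning
  k : ℕ → Series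
  k i = F i *ˢ recip F (n ∸ i)
  h : Fin n → Series
  h i = F (suc (toℕ i)) *ˢ Vec.lookup (recips F n) i
  S = sumˢ (applyUpTo suc n) k
  T = sumˢ (allFin n) h
  T≡S : T ≡ S
  T≡S = sum-tabulate n id suc h k λ i → cong (F (suc (toℕ i)) *ˢ_) (lookup-recips F n i)

D-constant : D 0 ≈ˢ 1ˢ
D-constant α = ℚ.+-identityʳ (1ˢ α)

{-# OPTIONS --safe #-}

-- Let E(z) = ∑ eᵢ zⁱ = ∏ (1 + x_c z) and let W_c(z) be the generating function
-- of the proper colourings of paths whose first vertex has colour c.  Deleting
-- that vertex gives (1 + x_c z) W_c = x_c z 𝒳_P, and 𝒳_P = 1 + ∑ W_c, so that
-- E 𝒳_P = E + z E′ 𝒳_P, which is 𝒳_P = E + G 𝒳_P.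
-- By inclusion and exclusion on the triangle at the end of the twinned path,
-- X_{P_{n,v}} = 2 X_{P_{n+1}} - 2 e₂ X_{P_{n-1}}.  Hence ½ 𝒳_{P_v} is
-- 𝒳_P G_{≥3} + ∑_{i≥2} eᵢ zⁱ, and substituting 𝒳_P = E / D with
-- E = D + K + e₁ z (D + G) gives the quotient form.
module Submission where

open import Defs
open import Algebra.Bundles using (CommutativeRing; RawRing)
open import Algebra.Morphism.Structures using (IsRingMonomorphism)
open import Algebra.Structures using (IsCommutativeRing)
import Algebra.Morphism.RingMonomorphism as RingMonomorphism
import Algebra.Properties.CommutativeMonoid.Mult as MonoidMult
import Algebra.Properties.CommutativeSemigroup as CommutativeSemigroupProperties
import Algebra.Properties.Group as GroupProperties
import Algebra.Properties.Semiring.Mult as SemiringMult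
import Algebra.Solver.Ring.NaturalCoefficients.Default as NatSolver
open import Data.Bool.Base using (Bool; true; false; if_then_else_; not; _∧_)
open import Data.Bool.Properties using (∧-zeroʳ)
open import Data.Empty using (⊥)
open import Data.Fin.Base as Fin using (Fin; zero; suc; toℕ; fromℕ; inject₁; opposite)
open import Data.Fin.Properties using (_≟_)
import Data.Fin.Properties as Fin
open import Data.Integer.Base as ℤ using (+_)
import Data.Integer.Properties as ℤ
open import Data.List.Base as List using (List; []; _∷_; _++_; map; foldr; filter; length; upTo; applyUpTo; allFin; cartesianProductWith)
open import Data.List.Properties using (≡-dec)
open import Data.List.Relation.Binary.Permutation.Propositional as Perm using (_↭_; ↭-sym)
open import Data.List.Relation.Binary.Permutation.Propositional.Properties using (All-resp-↭)
open import Data.List.Relation.Unary.All as All using (All; []; _∷_)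
import Data.List.Relation.Unary.All.Properties as All
open import Data.List.Relation.Unary.AllPairs using (AllPairs; []; _∷_)
import Data.List.Relation.Unary.AllPairs.Properties as AllPairs
import Data.List.Sort as Sort
open import Data.Nat.Base as ℕ using (ℕ; zero; suc; pred; _∸_; NonZero; s≤s; z≤n)
open import Data.Nat.Coprimality as Coprime using (1-coprimeTo)
open import Data.Nat.Induction using (<-rec)
import Data.Nat.Properties as ℕ
open import Data.Product.Base using (Σ-syntax; _×_; _,_; proj₁; proj₂)
open import Data.Rational.Base as ℚ using (ℚ; 0ℚ; 1ℚ; ½; _/_)
import Data.Rational.Properties as ℚ
open import Data.Sum.Base as Sum using (_⊎_; inj₁; inj₂)
open import Data.Vec.Base using (Vec; []; _∷_; _∷ʳ_; reverse; lookup; count)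
open import Data.Vec.Properties using (reverse-∷; reverse-involutive)
open import Function.Base using (_∘_; id; flip; _on_)
open import Function.Bundles using (_⇔_; mk⇔)
open import Level using (0ℓ)
import Relation.Binary.Construct.Flip.EqAndOrd as Flip
open import Relation.Binary.PropositionalEquality as ≡ using (_≡_; _≢_)
import Relation.Binary.Reasoning.Setoid as SetoidReasoning
open import Relation.Nullary.Decidable using (Dec; yes; no; does; ¬?; _×-dec_; does-⇔; dec-false)
open import Relation.Nullary.Negation using (¬_; contradiction)
open import Relation.Unary using (Decidable)

-- The laws of `_*ˢ_` are awkward to prove on `splits`. Reading off the first exponent instead
-- embeds the series in k + 1 variables into the power series over the series in k variables, so the
-- ring laws come by induction on k; the same `PowerSeries` serves once more for z. All counting
-- takes place in an arbitrary commutative ring with arbitrary weights for the colours, which only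
-- afterwards become variables. The factor 1 + x_c z is never inverted, and the reciprocal of D
-- enters only as a solution Q of Q = 1 + G Q. Differences are avoided by adding a term to both
-- sides and cancelling it, which leaves identities of commutative semirings for the solver.
-- Positivity comes from 𝒳_P = E + G 𝒳_P and not from the quotient: G starts in degree 2 and has
-- nonnegative coefficients, so strong induction on the length settles the paths, and 𝒳_P G_{≥3} + ∑
-- eᵢ zⁱ inherits the property.

-- Power series over a commutative ring

module PowerSeries {c ℓ} (R : CommutativeRing c ℓ) where
  open CommutativeRing R hiding (zero)
  open SetoidReasoning setoid
  open NatSolver commutativeSemiring using (solve; _:=_; _:+_; _:*_)

  sumOver : {A : Set} → List A → (A → Carrier) → Carrier
  sumOver xs f = foldr (λ x s → f x + s) 0# xs

  PS : Set c
  PS = ℕ → Carrier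

  infix  4 _≋_
  infixl 6 _⊕_
  infixl 7 _⊛_

  _≋_ : PS → PS → Set ℓ
  F ≋ G = ∀ n → F n ≈ G n

  -- The product has the shape of `_*ᶻ_`, so over the series ring the two agree definitionally and
  -- statements about one are statements about the other.
  _⊕_ _⊛_ : PS → PS → PS
  (F ⊕ G) n = F n + G n
  (F ⊛ G) n = sumOver (upTo (suc n)) λ i → F i * G (n ∸ i)

  ⊖_ : PS → PS
  (⊖ F) n = - F n

  𝟘 𝟙 : PS
  𝟘 n = 0#
  𝟙 zero    = 1#
  𝟙 (suc _) = 0#

  sumOver-cong : ∀ {A : Set} (xs : List A) {f g : A → Carrier} →
    (∀ x → f x ≈ g x) → sumOver xs f ≈ sumOver xs g
  sumOver-cong []       p = refl
  sumOver-cong (x ∷ xs) p = +-cong (p x) (sumOver-cong xs p)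

  sumOver-applyUpTo-suc : ∀ (s : ℕ → ℕ) n (f : ℕ → Carrier) →
    sumOver (applyUpTo (suc ∘ s) n) f ≡ sumOver (applyUpTo s n) (f ∘ suc)
  sumOver-applyUpTo-suc s zero    f = ≡.refl
  sumOver-applyUpTo-suc s (suc n) f = ≡.cong (λ t → f (suc (s 0)) + t) (sumOver-applyUpTo-suc (s ∘ suc) n f)

  ⊛-zero : ∀ F G → (F ⊛ G) 0 ≈ F 0 * G 0
  ⊛-zero F G = +-identityʳ _

  -- Peeling off the constant term of the left factor turns the convolution into a recursion on the
  -- degree; the ring laws are inductions along it.
  ⊛-suc : ∀ F G n → (F ⊛ G) (suc n) ≈ F 0 * G (suc n) + ((F ∘ suc) ⊛ G) n
  ⊛-suc F G n = +-congˡ (reflexive (sumOver-applyUpTo-suc id (suc n) _))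

  ⊛-cong : ∀ {F F′ G G′} → F ≋ F′ → G ≋ G′ → F ⊛ G ≋ F′ ⊛ G′
  ⊛-cong p q n = sumOver-cong (upTo (suc n)) λ i → *-cong (p i) (q (n ∸ i))

  ⊛-distribʳ : ∀ H F G → (F ⊕ G) ⊛ H ≋ F ⊛ H ⊕ G ⊛ H
  ⊛-distribʳ H F G zero = begin
    ((F ⊕ G) ⊛ H) 0            ≈⟨ ⊛-zero (F ⊕ G) H ⟩
    (F 0 + G 0) * H 0          ≈⟨ distribʳ (H 0) (F 0) (G 0) ⟩
    F 0 * H 0 + G 0 * H 0      ≈⟨ +-cong (⊛-zero F H) (⊛-zero G H) ⟨
    (F ⊛ H) 0 + (G ⊛ H) 0      ∎
  ⊛-distribʳ H F G (suc n) = begin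
    ((F ⊕ G) ⊛ H) (suc n)
      ≈⟨ ⊛-suc (F ⊕ G) H n ⟩
    (F 0 + G 0) * H (suc n) + (((F ∘ suc) ⊕ (G ∘ suc)) ⊛ H) n
      ≈⟨ +-congˡ (⊛-distribʳ H (F ∘ suc) (G ∘ suc) n) ⟩
    (F 0 + G 0) * H (suc n) + (((F ∘ suc) ⊛ H) n + ((G ∘ suc) ⊛ H) n)
      ≈⟨ solve 5 (λ f g h x y → (f :+ g) :* h :+ (x :+ y) := (f :* h :+ x) :+ (g :* h :+ y))
           refl (F 0) (G 0) (H (suc n)) _ _ ⟩
    (F 0 * H (suc n) + ((F ∘ suc) ⊛ H) n) + (G 0 * H (suc n) + ((G ∘ suc) ⊛ H) n)
      ≈⟨ +-cong (⊛-suc F H n) (⊛-suc G H n) ⟨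
    (F ⊛ H) (suc n) + (G ⊛ H) (suc n) ∎

  -- Needed for associativity: the shifted product `(F ⊛ G) ∘ suc` contains the tail of `G` scaled
  -- by `F 0`.
  ⊛-scaleˡ : ∀ a F G n → ((λ i → a * F i) ⊛ G) n ≈ a * (F ⊛ G) n
  ⊛-scaleˡ a F G zero = begin
    ((λ i → a * F i) ⊛ G) 0  ≈⟨ ⊛-zero (λ i → a * F i) G ⟩
    a * F 0 * G 0            ≈⟨ *-assoc a (F 0) (G 0) ⟩
    a * (F 0 * G 0)          ≈⟨ *-congˡ (⊛-zero F G) ⟨
    a * (F ⊛ G) 0            ∎
  ⊛-scaleˡ a F G (suc n) = begin
    ((λ i → a * F i) ⊛ G) (suc n)
      ≈⟨ ⊛-suc (λ i → a * F i) G n ⟩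
    a * F 0 * G (suc n) + ((λ i → a * F (suc i)) ⊛ G) n
      ≈⟨ +-cong (*-assoc a (F 0) _) (⊛-scaleˡ a (F ∘ suc) G n) ⟩
    a * (F 0 * G (suc n)) + a * ((F ∘ suc) ⊛ G) n
      ≈⟨ distribˡ a _ _ ⟨
    a * (F 0 * G (suc n) + ((F ∘ suc) ⊛ G) n)
      ≈⟨ *-congˡ (⊛-suc F G n) ⟨
    a * (F ⊛ G) (suc n) ∎

  ⊛-assoc : ∀ F G H → (F ⊛ G) ⊛ H ≋ F ⊛ (G ⊛ H)
  ⊛-assoc F G H zero = begin
    ((F ⊛ G) ⊛ H) 0      ≈⟨ ⊛-zero (F ⊛ G) H ⟩
    (F ⊛ G) 0 * H 0      ≈⟨ *-congʳ (⊛-zero F G) ⟩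
    F 0 * G 0 * H 0      ≈⟨ *-assoc (F 0) (G 0) (H 0) ⟩
    F 0 * (G 0 * H 0)    ≈⟨ *-congˡ (⊛-zero G H) ⟨
    F 0 * (G ⊛ H) 0      ≈⟨ ⊛-zero F (G ⊛ H) ⟨
    (F ⊛ (G ⊛ H)) 0      ∎
  ⊛-assoc F G H (suc n) = begin
    ((F ⊛ G) ⊛ H) (suc n)
      ≈⟨ ⊛-suc (F ⊛ G) H n ⟩
    (F ⊛ G) 0 * H (suc n) + (((F ⊛ G) ∘ suc) ⊛ H) n
      ≈⟨ +-cong (*-congʳ (⊛-zero F G)) (⊛-cong {G = H} (⊛-suc F G) (λ _ → refl) n) ⟩
    F 0 * G 0 * H (suc n) + (((λ i → F 0 * G (suc i)) ⊕ (F ∘ suc) ⊛ G) ⊛ H) n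
      ≈⟨ +-congˡ (⊛-distribʳ H (λ i → F 0 * G (suc i)) ((F ∘ suc) ⊛ G) n) ⟩
    F 0 * G 0 * H (suc n) + (((λ i → F 0 * G (suc i)) ⊛ H) n + (((F ∘ suc) ⊛ G) ⊛ H) n)
      ≈⟨ +-congˡ (+-cong (⊛-scaleˡ (F 0) (G ∘ suc) H n) (⊛-assoc (F ∘ suc) G H n)) ⟩
    F 0 * G 0 * H (suc n) + (F 0 * ((G ∘ suc) ⊛ H) n + ((F ∘ suc) ⊛ (G ⊛ H)) n)
      ≈⟨ solve 5 (λ f g h x y → f :* g :* h :+ (f :* x :+ y) := f :* (g :* h :+ x) :+ y)
           refl (F 0) (G 0) (H (suc n)) _ _ ⟩
    F 0 * (G 0 * H (suc n) + ((G ∘ suc) ⊛ H) n) + ((F ∘ suc) ⊛ (G ⊛ H)) n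
      ≈⟨ +-congʳ (*-congˡ (⊛-suc G H n)) ⟨
    F 0 * (G ⊛ H) (suc n) + ((F ∘ suc) ⊛ (G ⊛ H)) n
      ≈⟨ ⊛-suc F (G ⊛ H) n ⟨
    (F ⊛ (G ⊛ H)) (suc n) ∎

  -- The mirror image of `⊛-suc`, with the constant term of the right factor peeled off;
  -- commutativity plays the two against each other.
  ⊛-sucʳ : ∀ F G n → (F ⊛ G) (suc n) ≈ (F ⊛ (G ∘ suc)) n + F (suc n) * G 0
  ⊛-sucʳ F G zero = begin
    (F ⊛ G) 1                         ≈⟨ ⊛-suc F G 0 ⟩
    F 0 * G 1 + ((F ∘ suc) ⊛ G) 0     ≈⟨ +-cong (sym (⊛-zero F (G ∘ suc))) (⊛-zero (F ∘ suc) G) ⟩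
    (F ⊛ (G ∘ suc)) 0 + F 1 * G 0     ∎
  ⊛-sucʳ F G (suc n) = begin
    (F ⊛ G) (suc (suc n))
      ≈⟨ ⊛-suc F G (suc n) ⟩
    F 0 * G (suc (suc n)) + ((F ∘ suc) ⊛ G) (suc n)
      ≈⟨ +-congˡ (⊛-sucʳ (F ∘ suc) G n) ⟩
    F 0 * G (suc (suc n)) + (((F ∘ suc) ⊛ (G ∘ suc)) n + F (suc (suc n)) * G 0)
      ≈⟨ +-assoc _ _ _ ⟨
    F 0 * G (suc (suc n)) + ((F ∘ suc) ⊛ (G ∘ suc)) n + F (suc (suc n)) * G 0
      ≈⟨ +-congʳ (⊛-suc F (G ∘ suc) n) ⟨
    (F ⊛ (G ∘ suc)) (suc n) + F (suc (suc n)) * G 0 ∎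

  ⊛-comm : ∀ F G → F ⊛ G ≋ G ⊛ F
  ⊛-comm F G zero = begin
    (F ⊛ G) 0  ≈⟨ ⊛-zero F G ⟩
    F 0 * G 0  ≈⟨ *-comm (F 0) (G 0) ⟩
    G 0 * F 0  ≈⟨ ⊛-zero G F ⟨
    (G ⊛ F) 0  ∎
  ⊛-comm F G (suc n) = begin
    (F ⊛ G) (suc n)                          ≈⟨ ⊛-suc F G n ⟩
    F 0 * G (suc n) + ((F ∘ suc) ⊛ G) n      ≈⟨ +-cong (*-comm (F 0) _) (⊛-comm (F ∘ suc) G n) ⟩
    G (suc n) * F 0 + (G ⊛ (F ∘ suc)) n      ≈⟨ +-comm _ _ ⟩
    (G ⊛ (F ∘ suc)) n + G (suc n) * F 0      ≈⟨ ⊛-sucʳ G F n ⟨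
    (G ⊛ F) (suc n)                          ∎

  ⊛-zeroˡ : ∀ F → 𝟘 ⊛ F ≋ 𝟘
  ⊛-zeroˡ F zero    = trans (⊛-zero 𝟘 F) (zeroˡ _)
  ⊛-zeroˡ F (suc n) = trans (⊛-suc 𝟘 F n)
    (trans (+-cong (zeroˡ _) (⊛-zeroˡ F n)) (+-identityˡ 0#))

  ⊛-identityˡ : ∀ F → 𝟙 ⊛ F ≋ F
  ⊛-identityˡ F zero    = trans (⊛-zero 𝟙 F) (*-identityˡ _)
  ⊛-identityˡ F (suc n) = trans (⊛-suc 𝟙 F n)
    (trans (+-cong (*-identityˡ _) (⊛-zeroˡ F n)) (+-identityʳ _))

  powerSeries : CommutativeRing c ℓ
  powerSeries = record
    { Carrier = PS ; _≈_ = _≋_ ; _+_ = _⊕_ ; _*_ = _⊛_ ; -_ = ⊖_ ; 0# = 𝟘 ; 1# = 𝟙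
    ; isCommutativeRing = record
      { isRing = record
        { +-isAbelianGroup = record
          { isGroup = record
            { isMonoid = record
              { isSemigroup = record
                { isMagma = record
                  { isEquivalence = record
                    { refl  = λ n → refl
                    ; sym   = λ p n → sym (p n)
                    ; trans = λ p q n → trans (p n) (q n)
                    }
                  ; ∙-cong = λ p q n → +-cong (p n) (q n)
                  }
                ; assoc = λ F G H n → +-assoc (F n) (G n) (H n)
                }
              ; identity = (λ F n → +-identityˡ (F n)) , (λ F n → +-identityʳ (F n))
              }
            ; inverse = (λ F n → -‿inverseˡ (F n)) , (λ F n → -‿inverseʳ (F n))
            ; ⁻¹-cong = λ p n → -‿cong (p n)
            }
          ; comm = λ F G n → +-comm (F n) (G n)
          }
        ; *-cong     = ⊛-cong
        ; *-assoc    = ⊛-assoc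
        ; *-identity = ⊛-identityˡ , λ F n → trans (⊛-comm F 𝟙 n) (⊛-identityˡ F n)
        ; distrib    = (λ F G H n → trans (⊛-comm F (G ⊕ H) n)
                          (trans (⊛-distribʳ F G H n) (+-cong (⊛-comm G F n) (⊛-comm H F n))))
                     , ⊛-distribʳ
        }
      ; *-comm = ⊛-comm
      }
    }

-- Finite sums over colours and colourings

module FiniteSums {c ℓ} (R : CommutativeRing c ℓ) where
  open CommutativeRing R hiding (zero)
  open SetoidReasoning setoid
  open NatSolver commutativeSemiring using (solve; _:=_; _:+_; _:*_)

  Σᶠ : ∀ k → (Fin k → Carrier) → Carrier
  Σᶠ zero    f = 0#
  Σᶠ (suc k) f = f zero + Σᶠ k (f ∘ suc)

  Σᶠ-cong : ∀ k {f g : Fin k → Carrier} → (∀ c → f c ≈ g c) → Σᶠ k f ≈ Σᶠ k g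
  Σᶠ-cong zero    p = refl
  Σᶠ-cong (suc k) p = +-cong (p zero) (Σᶠ-cong k (p ∘ suc))

  Σᶠ-zero : ∀ k {f : Fin k → Carrier} → (∀ c → f c ≈ 0#) → Σᶠ k f ≈ 0#
  Σᶠ-zero zero    p = refl
  Σᶠ-zero (suc k) p = trans (+-cong (p zero) (Σᶠ-zero k (p ∘ suc))) (+-identityˡ 0#)

  Σᶠ-+ : ∀ k (f g : Fin k → Carrier) → Σᶠ k (λ c → f c + g c) ≈ Σᶠ k f + Σᶠ k g
  Σᶠ-+ zero    f g = sym (+-identityˡ 0#)
  Σᶠ-+ (suc k) f g = trans (+-congˡ (Σᶠ-+ k (f ∘ suc) (g ∘ suc)))
    (solve 4 (λ a b x y → (a :+ b) :+ (x :+ y) := (a :+ x) :+ (b :+ y)) refl _ _ _ _)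

  Σᶠ-*ˡ : ∀ k a (f : Fin k → Carrier) → Σᶠ k (λ c → a * f c) ≈ a * Σᶠ k f
  Σᶠ-*ˡ zero    a f = sym (zeroʳ a)
  Σᶠ-*ˡ (suc k) a f = trans (+-congˡ (Σᶠ-*ˡ k a (f ∘ suc))) (sym (distribˡ a _ _))

  Σᶠ-swap : ∀ k l (f : Fin k → Fin l → Carrier) →
    Σᶠ k (λ c → Σᶠ l (f c)) ≈ Σᶠ l (λ d → Σᶠ k (λ c → f c d))
  Σᶠ-swap zero    l f = sym (Σᶠ-zero l λ _ → refl)
  Σᶠ-swap (suc k) l f = trans (+-congˡ (Σᶠ-swap k l (f ∘ suc))) (sym (Σᶠ-+ l (f zero) _))

  when : Bool → Carrier → Carrier
  when b x = if b then x else 0#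

  when-cong : ∀ b {x y} → x ≈ y → when b x ≈ when b y
  when-cong true  p = p
  when-cong false p = refl

  when-*ˡ : ∀ b a x → when b (a * x) ≈ a * when b x
  when-*ˡ true  a x = refl
  when-*ˡ false a x = sym (zeroʳ a)

  when-+ : ∀ b x y → when b (x + y) ≈ when b x + when b y
  when-+ true  x y = refl
  when-+ false x y = sym (+-identityˡ 0#)

  when-∧ : ∀ b b′ x → when (b ∧ b′) x ≈ when b (when b′ x)
  when-∧ true  b′ x = refl
  when-∧ false b′ x = refl

  when-split : ∀ b p x → when (not b ∧ p) x + when (b ∧ p) x ≈ when p x
  when-split true  p x = +-identityˡ _
  when-split false p x = +-identityʳ _

  Σᶠ-δ : ∀ k c (f : Fin k → Carrier) → Σᶠ k (λ d → when (does (c ≟ d)) (f d)) ≈ f c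
  Σᶠ-δ (suc k) zero    f = trans (+-congˡ (Σᶠ-zero k λ _ → refl)) (+-identityʳ _)
  Σᶠ-δ (suc k) (suc c) f = trans (+-identityˡ _) (Σᶠ-δ k c (f ∘ suc))

  module _ {k : ℕ} where

    colSum : ∀ n → (Vec (Fin k) n → Carrier) → Carrier
    colSum zero    f = f []
    colSum (suc n) f = Σᶠ k λ c → colSum n (f ∘ (c ∷_))

    colSum-cong : ∀ n {f g : Vec (Fin k) n → Carrier} → (∀ κ → f κ ≈ g κ) → colSum n f ≈ colSum n g
    colSum-cong zero    p = p []
    colSum-cong (suc n) p = Σᶠ-cong k λ c → colSum-cong n (p ∘ (c ∷_))

    colSum-zero : ∀ n {f : Vec (Fin k) n → Carrier} → (∀ κ → f κ ≈ 0#) → colSum n f ≈ 0#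
    colSum-zero zero    p = p []
    colSum-zero (suc n) p = Σᶠ-zero k λ c → colSum-zero n (p ∘ (c ∷_))

    colSum-+ : ∀ n (f g : Vec (Fin k) n → Carrier) →
      colSum n (λ κ → f κ + g κ) ≈ colSum n f + colSum n g
    colSum-+ zero    f g = refl
    colSum-+ (suc n) f g =
      trans (Σᶠ-cong k λ c → colSum-+ n (f ∘ (c ∷_)) (g ∘ (c ∷_))) (Σᶠ-+ k _ _)

    colSum-*ˡ : ∀ n a (f : Vec (Fin k) n → Carrier) → colSum n (λ κ → a * f κ) ≈ a * colSum n f
    colSum-*ˡ zero    a f = refl
    colSum-*ˡ (suc n) a f = trans (Σᶠ-cong k λ c → colSum-*ˡ n a (f ∘ (c ∷_))) (Σᶠ-*ˡ k a _)

    colSum-when : ∀ n b (f : Vec (Fin k) n → Carrier) → colSum n (λ κ → when b (f κ)) ≈ when b (colSum n f)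
    colSum-when n true  f = refl
    colSum-when n false f = colSum-zero n λ _ → refl

    colSum-Σᶠ : ∀ n (f : Fin k → Vec (Fin k) n → Carrier) →
      colSum n (λ κ → Σᶠ k λ c → f c κ) ≈ Σᶠ k λ c → colSum n (f c)
    colSum-Σᶠ zero    f = refl
    colSum-Σᶠ (suc n) f = trans (Σᶠ-cong k λ d → colSum-Σᶠ n λ c → f c ∘ (d ∷_)) (Σᶠ-swap k k _)

    colSum-∷ʳ : ∀ n (f : Vec (Fin k) (suc n) → Carrier) →
      colSum n (λ κ → Σᶠ k λ c → f (κ ∷ʳ c)) ≈ colSum (suc n) f
    colSum-∷ʳ zero    f = refl
    colSum-∷ʳ (suc n) f = Σᶠ-cong k λ d → colSum-∷ʳ n (f ∘ (d ∷_))

    -- The sum over the first colour is moved inside all the others, where it becomes the sum over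
    -- the last. This serves to carry a twin at the last vertex of a path to the first.
    colSum-reverse : ∀ n (f : Vec (Fin k) n → Carrier) → colSum n (f ∘ reverse) ≈ colSum n f
    colSum-reverse zero    f = refl
    colSum-reverse (suc n) f = begin
      Σᶠ k (λ c → colSum n (λ κ → f (reverse (c ∷ κ))))
        ≈⟨ Σᶠ-cong k (λ c → colSum-cong n λ κ → reflexive (≡.cong f (reverse-∷ c κ))) ⟩
      Σᶠ k (λ c → colSum n (λ κ → f (reverse κ ∷ʳ c)))
        ≈⟨ Σᶠ-cong k (λ c → colSum-reverse n λ κ → f (κ ∷ʳ c)) ⟩
      Σᶠ k (λ c → colSum n (λ κ → f (κ ∷ʳ c)))
        ≈⟨ colSum-Σᶠ n (λ c κ → f (κ ∷ʳ c)) ⟨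
      colSum n (λ κ → Σᶠ k λ c → f (κ ∷ʳ c))
        ≈⟨ colSum-∷ʳ n f ⟩
      colSum (suc n) f ∎

  ∏1+ : ∀ k → (Fin k → Carrier) → Carrier
  ∏1+ zero    y = 1#
  ∏1+ (suc k) y = (1# + y zero) * ∏1+ k (y ∘ suc)

  -- ∑_c y_c ∏_{d ≠ c} (1 + y_d)
  ∏1+′ : ∀ k → (Fin k → Carrier) → Carrier
  ∏1+′ zero    y = 0#
  ∏1+′ (suc k) y = y zero * ∏1+ k (y ∘ suc) + (1# + y zero) * ∏1+′ k (y ∘ suc)

  -- With u_c = y_c A / (1 + y_c) this is the logarithmic derivative of the product.
  ∏1+-Σᶠ : ∀ k (y u : Fin k → Carrier) A → (∀ c → (1# + y c) * u c ≈ y c * A) →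
    ∏1+ k y * Σᶠ k u ≈ ∏1+′ k y * A
  ∏1+-Σᶠ zero    y u A p = trans (zeroʳ _) (sym (zeroˡ A))
  ∏1+-Σᶠ (suc k) y u A p = begin
    ((1# + y zero) * E) * (u zero + Σᶠ k (u ∘ suc))
      ≈⟨ solve 4 (λ t x a b → (t :* x) :* (a :+ b) := x :* (t :* a) :+ t :* (x :* b))
           refl (1# + y zero) E (u zero) _ ⟩
    E * ((1# + y zero) * u zero) + (1# + y zero) * (E * Σᶠ k (u ∘ suc))
      ≈⟨ +-cong (*-congˡ (p zero)) (*-congˡ (∏1+-Σᶠ k (y ∘ suc) (u ∘ suc) A (p ∘ suc))) ⟩
    E * (y zero * A) + (1# + y zero) * (∏1+′ k (y ∘ suc) * A)
      ≈⟨ solve 5 (λ x y₀ a t d → x :* (y₀ :* a) :+ t :* (d :* a) := (y₀ :* x :+ t :* d) :* a)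
           refl E (y zero) A (1# + y zero) _ ⟩
    (y zero * E + (1# + y zero) * ∏1+′ k (y ∘ suc)) * A ∎
    where E = ∏1+ k (y ∘ suc)

-- Weighted sums over proper colourings of paths and twinned paths

starts : ∀ {k n} → Fin k → Vec (Fin k) n → Bool
starts c []      = false
starts c (d ∷ _) = does (c ≟ d)

-- A Boolean recursion along the path, so that the counting never sees adjacency; agreement with
-- `proper?` is `does-path-proper?`.
pathOk : ∀ {k n} → Vec (Fin k) n → Bool
pathOk []      = true
pathOk (c ∷ κ) = not (starts c κ) ∧ pathOk κ

-- Here `c` colours the new vertex, `d` the end vertex, and `κ` the rest of the path, whose first
-- vertex is adjacent to both.
twinOk : ∀ {k n} → Vec (Fin k) (suc (suc n)) → Bool
twinOk (c ∷ d ∷ κ) = not (does (c ≟ d)) ∧ (not (starts c κ) ∧ (not (starts d κ) ∧ pathOk κ))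

-- The reason why inclusion and exclusion has no third term: two distinct colours cannot both be
-- that of the next vertex.
starts-exclusive : ∀ {k n} {c d : Fin k} (κ : Vec (Fin k) n) → c ≢ d → starts c κ ∧ starts d κ ≡ false
starts-exclusive                 []      c≢d = ≡.refl
starts-exclusive {c = c} {d = d} (f ∷ κ) c≢d with c ≟ f | d ≟ f
... | no  _      | _          = ≡.refl
... | yes _      | no _       = ≡.refl
... | yes ≡.refl | yes ≡.refl = contradiction ≡.refl c≢d

module Colourings {a ℓ} (R : CommutativeRing a ℓ) where
  open CommutativeRing R hiding (zero)
  open FiniteSums R
  open PowerSeries R
  open SetoidReasoning setoid
  open NatSolver commutativeSemiring using (solve; _:=_; _:+_; _:*_)
  open SemiringMult semiring using (×-comm-*; ×-congʳ) renaming (_×_ to _·_)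
  open MonoidMult +-commutativeMonoid using (×-distrib-+)
  open GroupProperties +-group using (∙-cancelʳ)
  private
    module S = CommutativeRing powerSeries
    module SΣ = FiniteSums powerSeries

  -- The series x z. With z read as the first variable it also represents that variable itself, in
  -- `xvar-*ˢ`.
  lin : Carrier → PS
  lin x (suc zero) = x
  lin x _          = 0#

  lin-⊛-zero : ∀ x F → (lin x ⊛ F) 0 ≈ 0#
  lin-⊛-zero x F = trans (⊛-zero (lin x) F) (zeroˡ _)

  lin-⊛-suc : ∀ x F n → (lin x ⊛ F) (suc n) ≈ x * F n
  lin-⊛-suc x F n = begin
    (lin x ⊛ F) (suc n)                  ≈⟨ ⊛-suc (lin x) F n ⟩
    0# * F (suc n) + ((lin x ∘ suc) ⊛ F) n ≈⟨ trans (+-congʳ (zeroˡ _)) (+-identityˡ _) ⟩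
    ((lin x ∘ suc) ⊛ F) n                ≈⟨ ⊛-cong {G = F} shift (λ _ → refl) n ⟩
    ((λ i → x * 𝟙 i) ⊛ F) n              ≈⟨ ⊛-scaleˡ x 𝟙 F n ⟩
    x * (𝟙 ⊛ F) n                        ≈⟨ *-congˡ (⊛-identityˡ F n) ⟩
    x * F n                              ∎
    where
    shift : lin x ∘ suc ≋ (λ i → x * 𝟙 i)
    shift zero    = sym (*-identityʳ x)
    shift (suc i) = sym (zeroʳ x)

  1+lin-⊛-zero : ∀ x F → ((𝟙 ⊕ lin x) ⊛ F) 0 ≈ F 0
  1+lin-⊛-zero x F = begin
    ((𝟙 ⊕ lin x) ⊛ F) 0       ≈⟨ ⊛-distribʳ F 𝟙 (lin x) 0 ⟩
    (𝟙 ⊛ F) 0 + (lin x ⊛ F) 0 ≈⟨ +-cong (⊛-identityˡ F 0) (lin-⊛-zero x F) ⟩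
    F 0 + 0#                  ≈⟨ +-identityʳ _ ⟩
    F 0                       ∎

  1+lin-⊛-suc : ∀ x F n → ((𝟙 ⊕ lin x) ⊛ F) (suc n) ≈ F (suc n) + x * F n
  1+lin-⊛-suc x F n = trans (⊛-distribʳ F 𝟙 (lin x) (suc n))
    (+-cong (⊛-identityˡ F (suc n)) (lin-⊛-suc x F n))

  -- The coefficients are the elementary symmetric polynomials in the weights; `e-≈-elem` identifies
  -- them with `e`.
  elem : ∀ k → (Fin k → Carrier) → PS
  elem k w = SΣ.∏1+ k (lin ∘ w)

  elem-0 : ∀ k (w : Fin k → Carrier) → elem k w 0 ≈ 1#
  elem-0 zero    w = refl
  elem-0 (suc k) w = trans (1+lin-⊛-zero (w zero) (elem k (w ∘ suc))) (elem-0 k (w ∘ suc))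

  elem-suc : ∀ k (w : Fin (suc k) → Carrier) n →
    elem (suc k) w (suc n) ≈ elem k (w ∘ suc) (suc n) + w zero * elem k (w ∘ suc) n
  elem-suc k w n = 1+lin-⊛-suc (w zero) (elem k (w ∘ suc)) n

  elem-1 : ∀ k (w : Fin k → Carrier) → elem k w 1 ≈ Σᶠ k w
  elem-1 zero    w = refl
  elem-1 (suc k) w = begin
    elem (suc k) w 1                                    ≈⟨ elem-suc k w 0 ⟩
    elem k (w ∘ suc) 1 + w zero * elem k (w ∘ suc) 0    ≈⟨ +-comm _ _ ⟩
    w zero * elem k (w ∘ suc) 0 + elem k (w ∘ suc) 1
      ≈⟨ +-cong (trans (*-congˡ (elem-0 k (w ∘ suc))) (*-identityʳ _)) (elem-1 k (w ∘ suc)) ⟩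
    w zero + Σᶠ k (w ∘ suc)                             ∎

  -- z ∂/∂z ∏ (1 + w_c z)
  ∏1+′-coefficient : ∀ k (w : Fin k → Carrier) n → SΣ.∏1+′ k (lin ∘ w) n ≈ n · elem k w n
  ∏1+′-coefficient zero    w zero    = refl
  ∏1+′-coefficient zero    w (suc n) = sym (n×0 (suc n))
    where
    n×0 : ∀ n → n · 0# ≈ 0#
    n×0 zero    = refl
    n×0 (suc n) = trans (+-identityˡ _) (n×0 n)
  ∏1+′-coefficient (suc k) w zero    = trans
    (+-cong (lin-⊛-zero (w zero) (elem k (w ∘ suc)))
      (trans (1+lin-⊛-zero (w zero) (SΣ.∏1+′ k (lin ∘ w ∘ suc))) (∏1+′-coefficient k (w ∘ suc) 0)))
    (+-identityˡ 0#)
  ∏1+′-coefficient (suc k) w (suc n) = begin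
    (lin x ⊛ E) (suc n) + ((𝟙 ⊕ lin x) ⊛ E′) (suc n)
      ≈⟨ +-cong (lin-⊛-suc x E n) (1+lin-⊛-suc x E′ n) ⟩
    x * E n + (E′ (suc n) + x * E′ n)
      ≈⟨ +-congˡ (+-cong (∏1+′-coefficient k (w ∘ suc) (suc n))
           (trans (*-congˡ (∏1+′-coefficient k (w ∘ suc) n)) (×-comm-* n x (E n)))) ⟩
    x * E n + (suc n · E (suc n) + n · (x * E n))
      ≈⟨ solve 3 (λ u v t → u :+ (v :+ t) := v :+ (u :+ t)) refl (x * E n) (suc n · E (suc n)) (n · (x * E n)) ⟩
    suc n · E (suc n) + suc n · (x * E n)
      ≈⟨ ×-distrib-+ (E (suc n)) (x * E n) (suc n) ⟨
    suc n · (E (suc n) + x * E n)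
      ≈⟨ ×-congʳ (suc n) (elem-suc k w n) ⟨
    suc n · elem (suc k) w (suc n) ∎
    where
    x  = w zero
    E  = elem k (w ∘ suc)
    E′ = SΣ.∏1+′ k (lin ∘ w ∘ suc)

  -- The colours of two adjacent vertices. The pairs are ordered, which is the source of the factor
  -- 2 in 2 e₂.
  pairSum : ∀ k → (Fin k → Carrier) → (Fin k → Fin k → Carrier) → Carrier
  pairSum k w f = Σᶠ k λ c → Σᶠ k λ d → when (not (does (c ≟ d))) (w c * (w d * f c d))

  pairSum-cong : ∀ k w {f g : Fin k → Fin k → Carrier} →
    (∀ c d → c ≢ d → f c d ≈ g c d) → pairSum k w f ≈ pairSum k w g
  pairSum-cong k w {f} {g} p = Σᶠ-cong k λ c → Σᶠ-cong k λ d → step c d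
    where
    step : ∀ c d → when (not (does (c ≟ d))) (w c * (w d * f c d)) ≈ when (not (does (c ≟ d))) (w c * (w d * g c d))
    step c d with c ≟ d
    ... | yes _  = refl
    ... | no c≢d = *-congˡ (*-congˡ (p c d c≢d))

  pairSum-+ : ∀ k w f g → pairSum k w (λ c d → f c d + g c d) ≈ pairSum k w f + pairSum k w g
  pairSum-+ k w f g = trans
    (Σᶠ-cong k λ c → trans
      (Σᶠ-cong k λ d → trans
        (when-cong (not (does (c ≟ d)))
          (solve 4 (λ x y u v → x :* (y :* (u :+ v)) := x :* (y :* u) :+ x :* (y :* v)) refl (w c) (w d) (f c d) (g c d)))
        (when-+ (not (does (c ≟ d))) _ _))
      (Σᶠ-+ k _ _))
    (Σᶠ-+ k _ _)

  pairSum-swap : ∀ k w f → pairSum k w f ≈ pairSum k w (flip f)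
  pairSum-swap k w f = trans (Σᶠ-swap k k _) (Σᶠ-cong k λ d → Σᶠ-cong k λ c → step c d)
    where
    step : ∀ c d → when (not (does (c ≟ d))) (w c * (w d * f c d)) ≈ when (not (does (d ≟ c))) (w d * (w c * f c d))
    step c d with c ≟ d | d ≟ c
    ... | yes _   | yes _   = refl
    ... | yes c≡d | no d≢c  = contradiction (≡.sym c≡d) d≢c
    ... | no c≢d  | yes d≡c = contradiction (≡.sym d≡c) c≢d
    ... | no _    | no _    = solve 3 (λ x y z → x :* (y :* z) := y :* (x :* z)) refl _ _ _

  pairSum-const : ∀ k w x → pairSum k w (λ _ _ → x) ≈ pairSum k w (λ _ _ → 1#) * x
  pairSum-const k w x = begin
    pairSum k w (λ _ _ → x)
      ≈⟨ Σᶠ-cong k (λ c → trans (Σᶠ-cong k λ d → trans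
           (when-cong (not (does (c ≟ d)))
             (trans (solve 3 (λ u v t → u :* (v :* t) := t :* (u :* v)) refl (w c) (w d) x)
                    (*-congˡ (*-congˡ (sym (*-identityʳ (w d)))))))
           (when-*ˡ (not (does (c ≟ d))) x _)) (Σᶠ-*ˡ k x _)) ⟩
    Σᶠ k (λ c → x * Σᶠ k (λ d → when (not (does (c ≟ d))) (w c * (w d * 1#))))
      ≈⟨ Σᶠ-*ˡ k x _ ⟩
    x * pairSum k w (λ _ _ → 1#)
      ≈⟨ *-comm x _ ⟩
    pairSum k w (λ _ _ → 1#) * x ∎

  -- Removing the colour `zero` leaves the pairs without it and x e₁ twice, once for each place that
  -- it can take; this is twice the recursion for e₂.
  pairSum-elem : ∀ k w → pairSum k w (λ _ _ → 1#) ≈ elem k w 2 + elem k w 2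
  pairSum-elem zero    w = sym (+-identityˡ 0#)
  pairSum-elem (suc k) w = begin
    (0# + Σᶠ k (λ d → x * (w (suc d) * 1#))) + Σᶠ k (λ c → w (suc c) * (x * 1#) + Σᶠ k (inner c))
      ≈⟨ +-cong (trans (+-identityˡ _) (trans (Σᶠ-*ˡ k x _) (*-congˡ (Σᶠ-cong k λ d → *-identityʳ _))))
           (trans (Σᶠ-+ k _ _) (+-congʳ (trans (Σᶠ-cong k λ c →
              trans (*-congˡ (*-identityʳ x)) (*-comm _ x)) (Σᶠ-*ˡ k x _)))) ⟩
    x * Σᶠ k (w ∘ suc) + (x * Σᶠ k (w ∘ suc) + pairSum k (w ∘ suc) (λ _ _ → 1#))
      ≈⟨ +-cong (*-congˡ (sym (elem-1 k (w ∘ suc))))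
           (+-cong (*-congˡ (sym (elem-1 k (w ∘ suc)))) (pairSum-elem k (w ∘ suc))) ⟩
    x * E 1 + (x * E 1 + (E 2 + E 2))
      ≈⟨ solve 2 (λ u v → u :+ (u :+ (v :+ v)) := (v :+ u) :+ (v :+ u)) refl (x * E 1) (E 2) ⟩
    (E 2 + x * E 1) + (E 2 + x * E 1)
      ≈⟨ +-cong (elem-suc k w 1) (elem-suc k w 1) ⟨
    elem (suc k) w 2 + elem (suc k) w 2 ∎
    where
    x = w zero
    E = elem k (w ∘ suc)
    inner : Fin k → Fin k → Carrier
    inner c d = when (not (does (c ≟ d))) (w (suc c) * (w (suc d) * 1#))

  module _ {k : ℕ} (w : Fin k → Carrier) where

    mon : ∀ {n} → Vec (Fin k) n → Carrier
    mon []      = 1#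
    mon (c ∷ κ) = w c * mon κ

    pathSum twinSum : PS
    pathSum n = colSum {k} n λ κ → when (pathOk κ) (mon κ)
    twinSum m = colSum {k} (suc (suc m)) λ κ → when (twinOk κ) (mon κ)

    -- The first is W_c; the second weighs what may follow a vertex of colour `c`.
    pathSum-starting pathSum-avoiding : Fin k → PS
    pathSum-starting c n = colSum n λ κ → when (starts c κ ∧ pathOk κ) (mon κ)
    pathSum-avoiding c n = colSum n λ κ → when (not (starts c κ) ∧ pathOk κ) (mon κ)

    pathSum-split : ∀ c n → pathSum-avoiding c n + pathSum-starting c n ≈ pathSum n
    pathSum-split c n = trans (sym (colSum-+ n _ _))
      (colSum-cong n λ κ → when-split (starts c κ) (pathOk κ) (mon κ))

    pathSum-suc : ∀ n → pathSum (suc n) ≈ Σᶠ k λ c → w c * pathSum-avoiding c n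
    pathSum-suc n = Σᶠ-cong k λ c →
      trans (colSum-cong n λ κ → when-*ˡ (not (starts c κ) ∧ pathOk κ) (w c) (mon κ)) (colSum-*ˡ n (w c) _)

    pathSum-starting-suc : ∀ c n → pathSum-starting c (suc n) ≈ w c * pathSum-avoiding c n
    pathSum-starting-suc c n = trans
      (Σᶠ-cong k λ d → begin
        colSum n (λ κ → when (does (c ≟ d) ∧ pathOk (d ∷ κ)) (w d * mon κ))
          ≈⟨ colSum-cong n (λ κ → when-∧ (does (c ≟ d)) _ _) ⟩
        colSum n (λ κ → when (does (c ≟ d)) (when (pathOk (d ∷ κ)) (w d * mon κ)))
          ≈⟨ colSum-when n (does (c ≟ d)) _ ⟩
        when (does (c ≟ d)) (colSum n (λ κ → when (pathOk (d ∷ κ)) (w d * mon κ)))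
          ≈⟨ when-cong (does (c ≟ d)) (trans
               (colSum-cong n λ κ → when-*ˡ (pathOk (d ∷ κ)) (w d) (mon κ)) (colSum-*ˡ n (w d) _)) ⟩
        when (does (c ≟ d)) (w d * pathSum-avoiding d n) ∎)
      (Σᶠ-δ k c λ d → w d * pathSum-avoiding d n)

    pathSum-avoiding-suc : ∀ c n →
      pathSum-avoiding c (suc n) ≈ Σᶠ k λ d → when (not (does (c ≟ d))) (w d * pathSum-avoiding d n)
    pathSum-avoiding-suc c n = Σᶠ-cong k λ d → begin
        colSum n (λ κ → when (not (does (c ≟ d)) ∧ pathOk (d ∷ κ)) (w d * mon κ))
          ≈⟨ colSum-cong n (λ κ → when-∧ (not (does (c ≟ d))) _ _) ⟩
        colSum n (λ κ → when (not (does (c ≟ d))) (when (pathOk (d ∷ κ)) (w d * mon κ)))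
          ≈⟨ colSum-when n (not (does (c ≟ d))) _ ⟩
        when (not (does (c ≟ d))) (colSum n (λ κ → when (pathOk (d ∷ κ)) (w d * mon κ)))
          ≈⟨ when-cong (not (does (c ≟ d))) (trans
               (colSum-cong n λ κ → when-*ˡ (pathOk (d ∷ κ)) (w d) (mon κ)) (colSum-*ˡ n (w d) _)) ⟩
        when (not (does (c ≟ d))) (w d * pathSum-avoiding d n) ∎

    -- A vertex of colour `c` is followed by a path avoiding `c`; adding x_c times the paths that
    -- start with `c` completes these to all paths.
    pathSum-starting-recurrence : ∀ c →
      (𝟙 ⊕ lin (w c)) ⊛ pathSum-starting c ≋ lin (w c) ⊛ pathSum
    pathSum-starting-recurrence c zero =
      trans (1+lin-⊛-zero (w c) (pathSum-starting c)) (sym (lin-⊛-zero (w c) pathSum))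
    pathSum-starting-recurrence c (suc n) = begin
      ((𝟙 ⊕ lin (w c)) ⊛ pathSum-starting c) (suc n)
        ≈⟨ 1+lin-⊛-suc (w c) (pathSum-starting c) n ⟩
      pathSum-starting c (suc n) + w c * pathSum-starting c n
        ≈⟨ +-congʳ (pathSum-starting-suc c n) ⟩
      w c * pathSum-avoiding c n + w c * pathSum-starting c n
        ≈⟨ distribˡ (w c) _ _ ⟨
      w c * (pathSum-avoiding c n + pathSum-starting c n)
        ≈⟨ *-congˡ (pathSum-split c n) ⟩
      w c * pathSum n
        ≈⟨ lin-⊛-suc (w c) pathSum n ⟨
      (lin (w c) ⊛ pathSum) (suc n) ∎

    -- The empty colouring starts with no colour, whence the summand `𝟙`.
    pathSum-≋-1+Σᶠ : pathSum ≋ 𝟙 ⊕ SΣ.Σᶠ k pathSum-starting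
    pathSum-≋-1+Σᶠ n = trans (coefficients n) (+-congˡ (sym (Σᶠ-coefficient k pathSum-starting n)))
      where
      Σᶠ-coefficient : ∀ k (F : Fin k → PS) n → SΣ.Σᶠ k F n ≈ Σᶠ k (λ c → F c n)
      Σᶠ-coefficient zero    F n = refl
      Σᶠ-coefficient (suc k) F n = +-congˡ (Σᶠ-coefficient k (F ∘ suc) n)
      coefficients : ∀ n → pathSum n ≈ 𝟙 n + Σᶠ k (λ c → pathSum-starting c n)
      coefficients zero    = sym (trans (+-congˡ (Σᶠ-zero k λ _ → refl)) (+-identityʳ 1#))
      coefficients (suc n) = trans (pathSum-suc n) (trans
        (Σᶠ-cong k λ c → sym (pathSum-starting-suc c n)) (sym (+-identityˡ _)))

    -- Since E + G = 1 + z E′, both E P + G P and P + z E′ P are the same series, and z E′ P cancels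
    -- against the one in E P = E + z E′ P.
    pathSum-≋ : pathSum ≋ elem k w ⊕ (λ n → (n ∸ 1) · elem k w n) ⊛ pathSum
    pathSum-≋ = S.sym (cancelʳ zE′P (E ⊕ Γ ⊛ P) P eq)
      where
      E = elem k w
      Γ : PS
      Γ n = (n ∸ 1) · elem k w n
      P = pathSum
      zE′ = SΣ.∏1+′ k (lin ∘ w)
      zE′P = zE′ ⊛ P
      open GroupProperties S.+-group using () renaming (∙-cancelʳ to cancelʳ)
      -- In degree n this is 1 + (n - 1) = n. Truncation makes `n ∸ 1` zero at n = 0, where the
      -- constant term of E supplies the `𝟙`.
      E+Γ : E ⊕ Γ ≋ 𝟙 ⊕ zE′
      E+Γ zero    = +-cong (elem-0 k w) (sym (∏1+′-coefficient k w 0))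
      E+Γ (suc n) = sym (trans (+-identityˡ _) (∏1+′-coefficient k w (suc n)))
      -- `∏1+-Σᶠ` with y_c = x_c z and u_c = W_c turns E ∑ W_c into z E′ P without dividing by any 1
      -- + x_c z.
      EP : E ⊛ P ≋ E ⊕ zE′P
      EP = S.trans (⊛-cong {E} S.refl pathSum-≋-1+Σᶠ)
        (S.trans (S.distribˡ E 𝟙 (SΣ.Σᶠ k pathSum-starting))
          (S.+-cong {E ⊛ 𝟙} (S.*-identityʳ E)
            (SΣ.∏1+-Σᶠ k (lin ∘ w) pathSum-starting P pathSum-starting-recurrence)))
      eq : (E ⊕ Γ ⊛ P) ⊕ zE′P ≋ P ⊕ zE′P
      eq n = begin
        (E n + (Γ ⊛ P) n) + zE′P n     ≈⟨ solve 3 (λ x y z → (x :+ y) :+ z := (x :+ z) :+ y) refl _ _ _ ⟩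
        (E n + zE′P n) + (Γ ⊛ P) n     ≈⟨ +-congʳ (EP n) ⟨
        (E ⊛ P) n + (Γ ⊛ P) n          ≈⟨ ⊛-distribʳ P E Γ n ⟨
        ((E ⊕ Γ) ⊛ P) n                ≈⟨ ⊛-cong {G = P} E+Γ (λ _ → refl) n ⟩
        ((𝟙 ⊕ zE′) ⊛ P) n              ≈⟨ ⊛-distribʳ P 𝟙 zE′ n ⟩
        (𝟙 ⊛ P) n + zE′P n             ≈⟨ +-congʳ (⊛-identityˡ P n) ⟩
        P n + zE′P n                   ∎

    -- Inclusion and exclusion over which of the two twins agrees with the next vertex.
    twinSum-≈ : ∀ m → twinSum m + (elem k w 2 + elem k w 2) * pathSum m ≈ pathSum (suc (suc m)) + pathSum (suc (suc m))
    twinSum-≈ m = trans (+-congˡ (*-congʳ (sym (pairSum-elem k w)))) (∙-cancelʳ (U + U) _ _ (begin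
      (twinSum m + QP) + (U + U)     ≈⟨ solve 3 (λ t q u → (t :+ q) :+ u := (t :+ u) :+ q) refl _ _ _ ⟩
      (twinSum m + (U + U)) + QP     ≈⟨ +-cong twin+U path+U ⟩
      QP + (P₂ + U)                  ≈⟨ +-congʳ path+U ⟩
      (P₂ + U) + (P₂ + U)            ≈⟨ solve 2 (λ p u → (p :+ u) :+ (p :+ u) := (p :+ p) :+ (u :+ u)) refl P₂ U ⟩
      (P₂ + P₂) + (U + U)            ∎))
      where
      P₂ = pathSum (suc (suc m))
      QP = pairSum k w (λ _ _ → 1#) * pathSum m
      -- The pairs whose second colour clashes with the first vertex of the remaining path. The plan
      -- is `twinSum m + 2U = QP` and `QP = P₂ + U`, so that `twinSum m + QP = 2P₂` once `2U` is
      -- cancelled.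
      U  = pairSum k w λ c d → pathSum-starting d m
      twinRest : Fin k → Fin k → Carrier
      twinRest c d = colSum m λ κ → when (not (starts c κ) ∧ (not (starts d κ) ∧ pathOk κ)) (mon κ)
      twinSum≈pairSum : twinSum m ≈ pairSum k w twinRest
      twinSum≈pairSum = Σᶠ-cong k λ c → Σᶠ-cong k λ d → begin
        colSum m (λ κ → when (twinOk (c ∷ d ∷ κ)) (w c * (w d * mon κ)))
          ≈⟨ colSum-cong m (λ κ → when-∧ (not (does (c ≟ d))) _ _) ⟩
        colSum m (λ κ → when (not (does (c ≟ d))) (when (ok c d κ) (w c * (w d * mon κ))))
          ≈⟨ colSum-when m (not (does (c ≟ d))) _ ⟩
        when (not (does (c ≟ d))) (colSum m (λ κ → when (ok c d κ) (w c * (w d * mon κ))))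
          ≈⟨ when-cong (not (does (c ≟ d))) (trans
               (colSum-cong m λ κ → trans (when-*ˡ (ok c d κ) (w c) _) (*-congˡ (when-*ˡ (ok c d κ) (w d) _)))
               (trans (colSum-*ˡ m (w c) _) (*-congˡ (colSum-*ˡ m (w d) _)))) ⟩
        when (not (does (c ≟ d))) (w c * (w d * twinRest c d)) ∎
        where
        ok : Fin k → Fin k → Vec (Fin k) m → Bool
        ok c d κ = not (starts c κ) ∧ (not (starts d κ) ∧ pathOk κ)
      -- Neither colour clashes, the first does, or the second does: as both cannot, these cases
      -- exhaust the colourings `p` without overlap.
      split : ∀ s t p x → s ∧ t ≡ false →
        when (not s ∧ (not t ∧ p)) x + (when (s ∧ p) x + when (t ∧ p) x) ≈ when p x
      split false t     p x q = trans (+-congˡ (+-identityˡ _)) (when-split t p x)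
      split true  false p x q = trans (+-identityˡ _) (+-identityʳ _)
      -- Either of the two twins may clash with the next vertex; exchanging them shows that both
      -- cases weigh `U`.
      twin+U : twinSum m + (U + U) ≈ QP
      twin+U = begin
        twinSum m + (U + U)
          ≈⟨ +-cong twinSum≈pairSum (+-congʳ (pairSum-swap k w _)) ⟩
        pairSum k w twinRest + (pairSum k w (λ c d → pathSum-starting c m) + U)
          ≈⟨ +-congˡ (pairSum-+ k w _ _) ⟨
        pairSum k w twinRest + pairSum k w (λ c d → pathSum-starting c m + pathSum-starting d m)
          ≈⟨ pairSum-+ k w _ _ ⟨
        pairSum k w (λ c d → twinRest c d + (pathSum-starting c m + pathSum-starting d m))
          ≈⟨ pairSum-cong k w (λ c d c≢d → trans (+-congˡ (sym (colSum-+ m _ _))) (trans (sym (colSum-+ m _ _))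
               (colSum-cong m λ κ → split (starts c κ) (starts d κ) (pathOk κ) (mon κ) (starts-exclusive κ c≢d)))) ⟩
        pairSum k w (λ _ _ → pathSum m)
          ≈⟨ pairSum-const k w (pathSum m) ⟩
        QP ∎
      -- In a path only the second of the first two vertices meets the rest, so `U` occurs once.
      path+U : QP ≈ P₂ + U
      path+U = sym (begin
        P₂ + U
          ≈⟨ +-congʳ (trans (pathSum-suc (suc m)) (Σᶠ-cong k λ c → trans (*-congˡ (pathSum-avoiding-suc c m))
               (trans (sym (Σᶠ-*ˡ k (w c) _)) (Σᶠ-cong k λ d → sym (when-*ˡ (not (does (c ≟ d))) (w c) _))))) ⟩
        pairSum k w (λ c d → pathSum-avoiding d m) + U
          ≈⟨ pairSum-+ k w _ _ ⟨
        pairSum k w (λ c d → pathSum-avoiding d m + pathSum-starting d m)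
          ≈⟨ pairSum-cong k w (λ c d _ → pathSum-split d m) ⟩
        pairSum k w (λ _ _ → pathSum m)
          ≈⟨ pairSum-const k w (pathSum m) ⟩
        QP ∎)

-- Algebra of the functional equations and of the initial values

module Identities {a ℓ} (R : CommutativeRing a ℓ) where
  open CommutativeRing R hiding (zero)
  open SetoidReasoning setoid
  open NatSolver commutativeSemiring using (solve; _:=_; _:+_; _:*_; con)
  open SemiringMult semiring using () renaming (_×_ to _·_)
  open GroupProperties +-group using (∙-cancelʳ)

  module _ {P E G Q : Carrier} (P≈ : P ≈ E + G * P) (Q≈ : Q ≈ 1# + G * Q) where

    -- This is P = E / (1 - G) without an inverse: each equation expands Q P in its own way, and the
    -- common summand G Q P is cancelled.
    P≈EQ : P ≈ E * Q
    P≈EQ = ∙-cancelʳ (G * (Q * P)) P (E * Q) (begin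
      P + G * (Q * P)             ≈⟨ solve 3 (λ p g q → p :+ g :* (q :* p) := (con 1 :+ g :* q) :* p) refl P G Q ⟩
      (1# + G * Q) * P            ≈⟨ *-congʳ Q≈ ⟨
      Q * P                       ≈⟨ *-congˡ P≈ ⟩
      Q * (E + G * P)             ≈⟨ solve 4 (λ p g q e → q :* (e :+ g :* p) := e :* q :+ g :* (q :* p)) refl P G Q E ⟩
      E * Q + G * (Q * P)         ∎)

    quotientForm : ∀ {G₃ E₂ K y a K₃} → E + G ≈ 1# + K + y → G₃ + E₂ ≈ a + K₃ →
      P * G₃ + E₂ ≈ K * (G₃ * Q) + y * G * (G₃ * Q) + a + K₃ + y * G₃
    quotientForm {G₃} {E₂} {K} {y} {a} {K₃} E+G G₃+E₂ = begin
      P * G₃ + E₂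
        ≈⟨ +-congʳ (*-congʳ (trans P≈EQ EQ)) ⟩
      (1# + K * Q + y * (1# + G * Q)) * G₃ + E₂
        ≈⟨ solve 6 (λ k q y g g₃ e₂ →
             (con 1 :+ k :* q :+ y :* (con 1 :+ g :* q)) :* g₃ :+ e₂ :=
             k :* (g₃ :* q) :+ y :* g :* (g₃ :* q) :+ (g₃ :+ e₂) :+ y :* g₃)
           refl K Q y G G₃ E₂ ⟩
      K * (G₃ * Q) + y * G * (G₃ * Q) + (G₃ + E₂) + y * G₃
        ≈⟨ +-congʳ (trans (+-congˡ G₃+E₂) (sym (+-assoc _ a K₃))) ⟩
      K * (G₃ * Q) + y * G * (G₃ * Q) + a + K₃ + y * G₃ ∎
      where
      -- That is, E/D = 1 + K/D + e₁z (1 + G/D). One copy of Q is expanded as 1 + G Q to cancel G Q,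
      -- the other to separate the terms y G G₃ Q and y G₃ of the result.
      EQ : E * Q ≈ 1# + K * Q + y * (1# + G * Q)
      EQ = ∙-cancelʳ (G * Q) _ _ (begin
        E * Q + G * Q
          ≈⟨ distribʳ Q E G ⟨
        (E + G) * Q
          ≈⟨ *-congʳ E+G ⟩
        (1# + K + y) * Q
          ≈⟨ trans (distribʳ Q _ y) (+-congʳ (trans (distribʳ Q 1# K) (+-congʳ (*-identityˡ Q)))) ⟩
        Q + K * Q + y * Q
          ≈⟨ +-cong (+-congʳ Q≈) (*-congˡ Q≈) ⟩
        1# + G * Q + K * Q + y * (1# + G * Q)
          ≈⟨ solve 4 (λ o g k t → o :+ g :+ k :+ t := o :+ k :+ t :+ g) refl 1# (G * Q) (K * Q) _ ⟩
        1# + K * Q + y * (1# + G * Q) + G * Q ∎)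

  -- Used with s the coefficient of `𝒴`, q = e₂ and p the shorter path: the correction of the twin
  -- cancels against those of the two paths.
  double-cancel : ∀ {t p q s} → t + (q + q) * p ≈ (s + q * p) + (s + q * p) → t ≈ s + s
  double-cancel {t} {p} {q} {s} h = ∙-cancelʳ ((q + q) * p) t (s + s) (trans h
    (solve 3 (λ p q s → (s :+ q :* p) :+ (s :+ q :* p) := (s :+ s) :+ (q :+ q) :* p) refl p q s))

  -- The left sides of `value₂` to `value₅` are the coefficients of z² to z⁵ in `𝒴` as the
  -- convolution unfolds: `xᵢ` stands for the path on i vertices, and the zeros are the coefficients
  -- of `G≥ 3` below degree 3.
  value₂ : ∀ x₀ x₁ x₂ e₂ → (x₀ * 0# + (x₁ * 0# + (x₂ * 0# + 0#))) + e₂ ≈ e₂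
  value₂ = solve 4 (λ x₀ x₁ x₂ e → (x₀ :* con 0 :+ (x₁ :* con 0 :+ (x₂ :* con 0 :+ con 0))) :+ e := e) refl

  value₃ : ∀ {x₀} x₁ x₂ x₃ e₃ → x₀ ≈ 1# →
    (x₀ * (2 · e₃) + (x₁ * 0# + (x₂ * 0# + (x₃ * 0# + 0#)))) + e₃ ≈ 3 · e₃
  value₃ x₁ x₂ x₃ e₃ p = trans
    (+-congʳ (+-congʳ (trans (*-congʳ p) (*-identityˡ _))))
    (solve 4 (λ x₁ x₂ x₃ e → ((e :+ (e :+ con 0)) :+ (x₁ :* con 0 :+ (x₂ :* con 0 :+ (x₃ :* con 0 :+ con 0)))) :+ e
      := e :+ (e :+ (e :+ con 0))) refl x₁ x₂ x₃ e₃)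

  value₄ : ∀ {x₀ x₁ e₁} x₂ x₃ x₄ e₃ e₄ → x₀ ≈ 1# → x₁ ≈ e₁ →
    (x₀ * (3 · e₄) + (x₁ * (2 · e₃) + (x₂ * 0# + (x₃ * 0# + (x₄ * 0# + 0#))))) + e₄ ≈ 4 · e₄ + 2 · (e₁ * e₃)
  value₄ {e₁ = e₁} x₂ x₃ x₄ e₃ e₄ p q = trans
    (+-congʳ (+-cong (trans (*-congʳ p) (*-identityˡ _)) (+-congʳ (*-congʳ q))))
    (solve 6 (λ e₁ x₂ x₃ x₄ e f → ((f :+ (f :+ (f :+ con 0))) :+ (e₁ :* (e :+ (e :+ con 0)) :+
          (x₂ :* con 0 :+ (x₃ :* con 0 :+ (x₄ :* con 0 :+ con 0))))) :+ f
      := (f :+ (f :+ (f :+ (f :+ con 0)))) :+ (e₁ :* e :+ (e₁ :* e :+ con 0))) refl e₁ x₂ x₃ x₄ e₃ e₄)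

  -- The coefficient 4 of e₂e₃ is the product of 2 e₂ for the path on two vertices and the term 2 e₃
  -- of `G≥ 3`.
  value₅ : ∀ {x₀ x₁ x₂ e₁ e₂} x₃ x₄ x₅ e₃ e₄ e₅ → x₀ ≈ 1# → x₁ ≈ e₁ → x₂ ≈ 2 · e₂ →
    (x₀ * (4 · e₅) + (x₁ * (3 · e₄) + (x₂ * (2 · e₃) + (x₃ * 0# + (x₄ * 0# + (x₅ * 0# + 0#)))))) + e₅
      ≈ 4 · (e₂ * e₃) + 3 · (e₁ * e₄) + 5 · e₅
  value₅ {e₁ = e₁} {e₂ = e₂} x₃ x₄ x₅ e₃ e₄ e₅ p q r = trans
    (+-congʳ (+-cong (trans (*-congʳ p) (*-identityˡ _)) (+-cong (*-congʳ q) (+-congʳ (*-congʳ r)))))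
    (solve 8 (λ e₁ e₂ x₃ x₄ x₅ e f g →
          ((g :+ (g :+ (g :+ (g :+ con 0)))) :+ (e₁ :* (f :+ (f :+ (f :+ con 0))) :+ ((e₂ :+ (e₂ :+ con 0)) :* (e :+ (e :+ con 0)) :+
          (x₃ :* con 0 :+ (x₄ :* con 0 :+ (x₅ :* con 0 :+ con 0)))))) :+ g
      := ((e₂ :* e :+ (e₂ :* e :+ (e₂ :* e :+ (e₂ :* e :+ con 0)))) :+ (e₁ :* f :+ (e₁ :* f :+ (e₁ :* f :+ con 0))))
          :+ (g :+ (g :+ (g :+ (g :+ (g :+ con 0)))))) refl e₁ e₂ x₃ x₄ x₅ e₃ e₄ e₅)

  pathValue₁ : ∀ e₁ x₀ x₁ → e₁ + (0# * x₁ + (0# * x₀ + 0#)) ≈ e₁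
  pathValue₁ = solve 3 (λ e x₀ x₁ → e :+ (con 0 :* x₁ :+ (con 0 :* x₀ :+ con 0)) := e) refl

  pathValue₂ : ∀ e₂ {x₀} x₁ x₂ → x₀ ≈ 1# → e₂ + (0# * x₂ + (0# * x₁ + ((1 · e₂) * x₀ + 0#))) ≈ 2 · e₂
  pathValue₂ e₂ x₁ x₂ p = trans
    (+-congˡ (+-congˡ (+-congˡ (+-congʳ (trans (*-congˡ p) (*-identityʳ _))))))
    (solve 3 (λ e x₁ x₂ → e :+ (con 0 :* x₂ :+ (con 0 :* x₁ :+ ((e :+ con 0) :+ con 0))) := e :+ (e :+ con 0)) refl e₂ x₁ x₂)

-- The order is reversed because partitions list their parts decreasingly.
open Sort (Flip.decTotalOrder ℕ.≤-decTotalOrder) using (sort; sort-↭; sort-↗)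
open ≡ using (refl; sym; trans; cong; cong₂; subst₂; module ≡-Reasoning)

-- The ring of series in k variables

-- The coefficient of a power of the first variable, as a series in the remaining ones; that
-- variable takes the role of z.
slice : Series → ZSeries
slice f i α = f (i ∷ α)

-ˢ_ : Series → Series
(-ˢ f) α = ℚ.- f α

infix 4 _≈[_]_
-- Equality of the restrictions to k variables. Being a record it does not unfold, so its sides can
-- be recovered from its type.
record _≈[_]_ (f : Series) (k : ℕ) (g : Series) : Set where
  constructor ⟨_⟩
  field at : ∀ α → length α ≡ k → f α ≡ g α
open _≈[_]_

≈[]⇒≡ : ∀ {f g} α → f ≈[ length α ] g → f α ≡ g α
≈[]⇒≡ α p = at p α refl

≈[]⇒≈ˢ : ∀ {f g} → (∀ k → f ≈[ k ] g) → f ≈ˢ g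
≈[]⇒≈ˢ p α = ≈[]⇒≡ α (p (length α))

≈ˢ⇒≈[] : ∀ {k f g} → f ≈ˢ g → f ≈[ k ] g
≈ˢ⇒≈[] p = ⟨ (λ α _ → p α) ⟩

≈[0] : ∀ {f g} → f [] ≡ g [] → f ≈[ 0 ] g
≈[0] p = ⟨ (λ { [] _ → p }) ⟩

slice-cong : ∀ {k f g} → f ≈[ suc k ] g → ∀ i → slice f i ≈[ k ] slice g i
slice-cong p i = ⟨ (λ α q → at p (i ∷ α) (cong suc q)) ⟩

slice-injective : ∀ {k f g} → (∀ i → slice f i ≈[ k ] slice g i) → f ≈[ suc k ] g
slice-injective p = ⟨ (λ { (a ∷ α) q → at (p a) α (ℕ.suc-injective q) }) ⟩

sumˢ-eval : ∀ {A : Set} (xs : List A) (F : A → Series) α → sumˢ xs F α ≡ sumℚ xs (λ x → F x α)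
sumˢ-eval []       F α = refl
sumˢ-eval (x ∷ xs) F α = cong (F x α ℚ.+_) (sumˢ-eval xs F α)

sumℚ-cartesianProductWith : ∀ {A B C : Set} (h : A → B → C) xs ys (t : C → ℚ) →
  sumℚ (cartesianProductWith h xs ys) t ≡ sumℚ xs λ x → sumℚ ys λ y → t (h x y)
sumℚ-cartesianProductWith h []       ys t = refl
sumℚ-cartesianProductWith h (x ∷ xs) ys t = trans (sumℚ-++ (map (h x) ys) _ t)
  (cong₂ ℚ._+_ (sumℚ-map (h x) ys t) (sumℚ-cartesianProductWith h xs ys t))

-- A product of series in k + 1 variables is the product of power series in
-- the first variable with coefficients in the ring of series in k variables.
slice-* : ∀ f g → slice (f *ˢ g) ≈ᶻ slice f *ᶻ slice g
slice-* f g a α = trans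
  (sumℚ-cartesianProductWith (λ i (β , γ) → i ∷ β , (a ∸ i) ∷ γ) (upTo (suc a)) (splits α)
    (λ (β , γ) → f β ℚ.* g γ))
  (sym (sumˢ-eval (upTo (suc a)) (λ i → slice f i *ˢ slice g (a ∸ i)) α))

seriesRawRing : ℕ → RawRing 0ℓ 0ℓ
seriesRawRing k = record
  { Carrier = Series ; _≈_ = _≈[ k ]_ ; _+_ = _+ˢ_ ; _*_ = _*ˢ_ ; -_ = -ˢ_ ; 0# = 0ˢ ; 1# = 1ˢ }

-- The laws are pulled back along injective homomorphisms: evaluation at `[]` into ℚ for k = 0, and
-- `slice` into the power series over the ring in k variables for k + 1. Carrier and operations are
-- the same for every k, so an identity proved for all k holds for `_≈ˢ_`.
seriesRing-isCommutativeRing : ∀ k → IsCommutativeRing _≈[ k ]_ _+ˢ_ _*ˢ_ -ˢ_ 0ˢ 1ˢ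
seriesRing : ℕ → CommutativeRing 0ℓ 0ℓ
seriesRing k = record
  { Carrier = Series ; _≈_ = _≈[ k ]_ ; _+_ = _+ˢ_ ; _*_ = _*ˢ_ ; -_ = -ˢ_ ; 0# = 0ˢ ; 1# = 1ˢ
  ; isCommutativeRing = seriesRing-isCommutativeRing k }

seriesRing-isCommutativeRing zero =
  RingMonomorphism.isCommutativeRing mono ℚ.+-*-isCommutativeRing
  where
  mono : IsRingMonomorphism (seriesRawRing 0) ℚ.+-*-rawRing (λ f → f [])
  mono = record
    { isRingHomomorphism = record
      { isSemiringHomomorphism = record
        { isNearSemiringHomomorphism = record
          { +-isMonoidHomomorphism = record
            { isMagmaHomomorphism = record
              { isRelHomomorphism = record { cong = λ p → ≈[]⇒≡ [] p }
              ; homo = λ f g → refl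
              }
            ; ε-homo = refl
            }
          ; *-homo = λ f g → ℚ.+-identityʳ _
          }
        ; 1#-homo = refl
        }
      ; -‿homo = λ f → refl
      }
    ; injective = ≈[0]
    }
seriesRing-isCommutativeRing (suc k) =
  RingMonomorphism.isCommutativeRing mono (CommutativeRing.isCommutativeRing S)
  where
  module R = CommutativeRing (seriesRing k)
  S = PowerSeries.powerSeries (seriesRing k)
  module S = CommutativeRing S
  slice-1 : ∀ n → slice 1ˢ n ≈[ k ] S.1# n
  slice-1 zero    = R.refl
  slice-1 (suc n) = R.refl
  mono : IsRingMonomorphism (seriesRawRing (suc k)) (CommutativeRing.rawRing S) slice
  mono = record
    { isRingHomomorphism = record
      { isSemiringHomomorphism = record
        { isNearSemiringHomomorphism = record
          { +-isMonoidHomomorphism = record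
            { isMagmaHomomorphism = record
              { isRelHomomorphism = record { cong = slice-cong }
              ; homo = λ f g n → R.refl
              }
            ; ε-homo = λ n → R.refl
            }
          ; *-homo = λ f g n → ≈ˢ⇒≈[] (slice-* f g n)
          }
        ; 1#-homo = slice-1
        }
      ; -‿homo = λ f n → R.refl
      }
    ; injective = slice-injective
    }

-- Chromatic symmetric functions as sums over colourings

module ℚΣ = FiniteSums ℚ.+-*-commutativeRing

-- For a variable n the fraction `+ n / 1` is stuck on a gcd; its reduced form lets the addition
-- compute.
fromℕ-suc : ∀ n → + suc n / 1 ≡ 1ℚ ℚ.+ (+ n / 1)
fromℕ-suc n = sym (begin
  1ℚ ℚ.+ (+ n / 1)
    ≡⟨ cong (1ℚ ℚ.+_) (ℚ.normalize-coprime {n} {0} (Coprime.sym (1-coprimeTo n))) ⟩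
  (+ 1 ℤ.* + 1 ℤ.+ + n ℤ.* + 1) / 1
    ≡⟨ cong (λ i → (+ 1 ℤ.+ i) / 1) (ℤ.*-identityʳ (+ n)) ⟩
  + suc n / 1 ∎)
  where open ≡-Reasoning

length-filter : ∀ {A : Set} {P : A → Set} (P? : Decidable P) xs →
  + length (filter P? xs) / 1 ≡ sumℚ xs λ x → ℚΣ.when (does (P? x)) 1ℚ
length-filter P? []       = refl
length-filter P? (x ∷ xs) with does (P? x)
... | true  = trans (fromℕ-suc (length (filter P? xs))) (cong (1ℚ ℚ.+_) (length-filter P? xs))
... | false = trans (length-filter P? xs) (sym (ℚ.+-identityˡ _))

sumℚ-tabulate : ∀ {A : Set} k (g : Fin k → A) f → sumℚ (List.tabulate g) f ≡ ℚΣ.Σᶠ k (f ∘ g)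
sumℚ-tabulate zero    g f = refl
sumℚ-tabulate (suc k) g f = cong (f (g zero) ℚ.+_) (sumℚ-tabulate k (g ∘ suc) f)

sumℚ-colourings : ∀ n k f → sumℚ (colourings n k) f ≡ ℚΣ.colSum n f
sumℚ-colourings zero    k f = ℚ.+-identityʳ _
sumℚ-colourings (suc n) k f = trans
  (sumℚ-cartesianProductWith _∷_ (allFin k) (colourings n k) f)
  (trans (sumℚ-tabulate k id _) (ℚΣ.Σᶠ-cong k λ c → sumℚ-colourings n k (f ∘ (c ∷_))))

X-colSum : ∀ {n} (H : Graph n) α → X H α ≡
  ℚΣ.colSum n λ κ → ℚΣ.when (does (proper? H κ) ∧ does (hasContent? α κ)) 1ℚ
X-colSum {n} H α = trans
  (length-filter (λ κ → proper? H κ ×-dec hasContent? α κ) (colourings n (length α)))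
  (sumℚ-colourings n (length α) _)

⋆-suc : ∀ n f → suc n ⋆ f ≈ˢ f +ˢ n ⋆ f
⋆-suc n f α = trans (cong (ℚ._* f α) (fromℕ-suc n))
  (trans (ℚ.*-distribʳ-+ (f α) 1ℚ (+ n / 1)) (cong (ℚ._+ (n ⋆ f) α) (ℚ.*-identityˡ (f α))))

0⋆ : ∀ f → 0 ⋆ f ≈ˢ 0ˢ
0⋆ f α = ℚ.*-zeroˡ (f α)

•ˢ-cong : ∀ c {f g} → f ≈ˢ g → c •ˢ f ≈ˢ c •ˢ g
•ˢ-cong c p α = cong (c ℚ.*_) (p α)

2⋆ : ∀ f → 2 ⋆ f ≈ˢ f +ˢ f
2⋆ f α = trans (⋆-suc 1 f α) (cong (f α ℚ.+_)
  (trans (⋆-suc 0 f α) (trans (cong (f α ℚ.+_) (0⋆ f α)) (ℚ.+-identityʳ (f α)))))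

½•-double : ∀ f → ½ •ˢ (f +ˢ f) ≈ˢ f
½•-double f α = trans (ℚ.*-distribˡ-+ ½ (f α) (f α))
  (trans (sym (ℚ.*-distribʳ-+ (f α) ½ ½)) (ℚ.*-identityˡ (f α)))

-- The value of ½ 𝒳_{P_v}, named without a vertex: the quotient form, the initial values and
-- positivity are all derived from it.
𝒴 : ZSeries
𝒴 = 𝒳-P *ᶻ G≥ 3 +ᶻ ∑≥ 2 e

-- Monomials and elementary symmetric functions

-- A variable, numbered from 0. It vanishes on lists too short to contain it, so a natural number
-- can index it for every k at once.
xvar : ℕ → Series
xvar c       []              = 0ℚ
xvar zero    (1 ∷ α)         = 1ˢ α
xvar zero    (_ ∷ α)         = 0ℚ
xvar (suc c) (zero ∷ α)      = xvar c α
xvar (suc c) (suc _ ∷ α)     = 0ℚ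

-- The product of `f` with a variable, by coefficients: the exponent of the variable is lowered, and
-- the coefficient is 0 if that is impossible.
shift : ℕ → Series → Series
shift c       f []          = 0ℚ
shift zero    f (zero ∷ α)  = 0ℚ
shift zero    f (suc a ∷ α) = f (a ∷ α)
shift (suc c) f (a ∷ α)     = shift c (slice f a) α

shift-zero : ∀ c {f} → f ≈ˢ 0ˢ → shift c f ≈ˢ 0ˢ
shift-zero c       p []          = refl
shift-zero zero    p (zero ∷ α)  = refl
shift-zero zero    p (suc a ∷ α) = p (a ∷ α)
shift-zero (suc c) p (a ∷ α)     = shift-zero c (p ∘ (a ∷_)) α

-- Sliced by the first variable, variable 0 is the linear series `lin 1ˢ`, and every other variable
-- is constant, which reduces c by one.
xvar-*ˢ : ∀ c f → xvar c *ˢ f ≈ˢ shift c f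
xvar-*ˢ c f [] = trans (ℚ.+-identityʳ _) (ℚ.*-zeroˡ (f []))
xvar-*ˢ zero f (a ∷ α) = trans (slice-* (xvar zero) f a α)
  (≈[]⇒≡ α (R.trans (⊛-cong {G = slice f} xvar≋lin (λ _ → R.refl) a) (go a)))
  where
  module R = CommutativeRing (seriesRing (length α))
  open PowerSeries (seriesRing (length α))
  open Colourings (seriesRing (length α)) using (lin; lin-⊛-zero; lin-⊛-suc)
  xvar≋lin : slice (xvar zero) ≋ lin 1ˢ
  xvar≋lin 0             = R.refl
  xvar≋lin 1             = R.refl
  xvar≋lin (suc (suc n)) = R.refl
  go : ∀ a → (lin 1ˢ ⊛ slice f) a ≈[ length α ] slice (shift zero f) a
  go zero    = lin-⊛-zero 1ˢ (slice f)
  go (suc a) = R.trans (lin-⊛-suc 1ˢ (slice f) a) (R.*-identityˡ (slice f a))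
xvar-*ˢ (suc c) f (a ∷ α) = trans (slice-* (xvar (suc c)) f a α)
  (trans (≈[]⇒≡ α (begin
    (slice (xvar (suc c)) ⊛ slice f) a  ≈⟨ ⊛-cong {G = slice f} xvar≋scale (λ _ → R.refl) a ⟩
    ((λ i → xvar c *ˢ 𝟙 i) ⊛ slice f) a ≈⟨ ⊛-scaleˡ (xvar c) 𝟙 (slice f) a ⟩
    xvar c *ˢ (𝟙 ⊛ slice f) a           ≈⟨ R.*-congˡ {xvar c} (⊛-identityˡ (slice f) a) ⟩
    xvar c *ˢ slice f a                 ∎))
    (xvar-*ˢ c (slice f a) α))
  where
  module R = CommutativeRing (seriesRing (length α))
  open PowerSeries (seriesRing (length α))
  open SetoidReasoning R.setoid
  xvar≋scale : slice (xvar (suc c)) ≋ (λ i → xvar c *ˢ 𝟙 i)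
  xvar≋scale zero    = R.sym (R.*-identityʳ (xvar c))
  xvar≋scale (suc i) = R.sym (R.zeroʳ (xvar c))

weight : ∀ k → Fin k → Series
weight k c = xvar (toℕ c)

-- A series in the remaining variables, seen as one in which the first variable does not occur.
constant : Series → Series
constant f []          = 0ℚ
constant f (zero ∷ α)  = f α
constant f (suc _ ∷ α) = 0ℚ

e-0 : e 0 ≈ˢ 1ˢ
e-0 []          = refl
e-0 (zero ∷ α)  = e-0 α
e-0 (suc a ∷ α) = cong (λ b → ℚΣ.when b 1ℚ) (∧-zeroʳ _)

module _ (j : ℕ) where
  private
    module R = CommutativeRing (seriesRing j)
    module R⁺ = CommutativeRing (seriesRing (suc j))
    module C = Colourings (seriesRing j)
    module C⁺ = Colourings (seriesRing (suc j))
  open SetoidReasoning R⁺.setoid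

  constant-cong : ∀ {f g} → f ≈[ j ] g → constant f ≈[ suc j ] constant g
  constant-cong p = slice-injective λ { zero → p ; (suc _) → R.refl }

  constant-1 : 1ˢ ≈[ suc j ] constant 1ˢ
  constant-1 = slice-injective λ { zero → R.refl ; (suc _) → R.refl }

  constant-+ : ∀ f g → constant f +ˢ constant g ≈[ suc j ] constant (f +ˢ g)
  constant-+ f g = slice-injective λ { zero → R.refl ; (suc _) → R.+-identityˡ 0ˢ }

  constant-xvar : ∀ c f → xvar (suc c) *ˢ constant f ≈[ suc j ] constant (xvar c *ˢ f)
  constant-xvar c f = slice-injective λ
    { zero    → ≈ˢ⇒≈[] λ α → trans (xvar-*ˢ (suc c) (constant f) (0 ∷ α)) (sym (xvar-*ˢ c f α))
    ; (suc i) → ≈ˢ⇒≈[] λ α → trans (xvar-*ˢ (suc c) (constant f) (suc i ∷ α)) (shift-zero c (λ _ → refl) α)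
    }

  -- No weight here is variable 0. The selection `φ` is arbitrary because the induction drops
  -- weights while the number of variables stays fixed.
  elem-constant : ∀ m (φ : Fin m → ℕ) i →
    C⁺.elem m (xvar ∘ suc ∘ φ) i ≈[ suc j ] constant (C.elem m (xvar ∘ φ) i)
  elem-constant zero    φ zero    = constant-1
  elem-constant zero    φ (suc i) = slice-injective λ { zero → R.refl ; (suc _) → R.refl }
  elem-constant (suc m) φ zero    = begin
    C⁺.elem (suc m) (xvar ∘ suc ∘ φ) 0        ≈⟨ C⁺.elem-0 (suc m) (xvar ∘ suc ∘ φ) ⟩
    1ˢ                                        ≈⟨ constant-1 ⟩
    constant 1ˢ                               ≈⟨ constant-cong (C.elem-0 (suc m) (xvar ∘ φ)) ⟨
    constant (C.elem (suc m) (xvar ∘ φ) 0)    ∎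
  elem-constant (suc m) φ (suc i) = begin
    C⁺.elem (suc m) (xvar ∘ suc ∘ φ) (suc i)
      ≈⟨ C⁺.elem-suc m (xvar ∘ suc ∘ φ) i ⟩
    C⁺.elem m (xvar ∘ suc ∘ φ ∘ suc) (suc i) +ˢ x⁺ *ˢ C⁺.elem m (xvar ∘ suc ∘ φ ∘ suc) i
      ≈⟨ R⁺.+-cong (elem-constant m (φ ∘ suc) (suc i))
           (R⁺.*-congˡ {x⁺} (elem-constant m (φ ∘ suc) i)) ⟩
    constant A +ˢ x⁺ *ˢ constant B
      ≈⟨ R⁺.+-congˡ {constant A} (constant-xvar (φ zero) B) ⟩
    constant A +ˢ constant (xvar (φ zero) *ˢ B)
      ≈⟨ constant-+ A (xvar (φ zero) *ˢ B) ⟩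
    constant (A +ˢ xvar (φ zero) *ˢ B)
      ≈⟨ constant-cong (C.elem-suc m (xvar ∘ φ) i) ⟨
    constant (C.elem (suc m) (xvar ∘ φ) (suc i)) ∎
    where
    x⁺ = xvar (suc (φ zero))
    A  = C.elem m (xvar ∘ φ ∘ suc) (suc i)
    B  = C.elem m (xvar ∘ φ ∘ suc) i

-- Both sides obey the recursion that removes the first variable: its squarefree monomials either
-- avoid it or contain it once.
e-≈-elem : ∀ k i → e i ≈[ k ] Colourings.elem (seriesRing k) k (weight k) i
e-≈-elem zero    zero    = ≈[0] refl
e-≈-elem zero    (suc i) = ≈[0] refl
e-≈-elem (suc k) zero    = R.trans (≈ˢ⇒≈[] e-0) (R.sym (C.elem-0 (suc k) (weight (suc k))))
  where
  module R = CommutativeRing (seriesRing (suc k))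
  module C = Colourings (seriesRing (suc k))
e-≈-elem (suc k) (suc i) = begin
  e (suc i)
    ≈⟨ e-suc ⟩
  constant (e (suc i)) +ˢ xvar 0 *ˢ constant (e i)
    ≈⟨ R.+-cong (constant-cong k (e-≈-elem k (suc i)))
         (R.*-congˡ {xvar 0} (constant-cong k (e-≈-elem k i))) ⟩
  constant (C⁻.elem k (weight k) (suc i)) +ˢ xvar 0 *ˢ constant (C⁻.elem k (weight k) i)
    ≈⟨ R.+-cong (elem-constant k k toℕ (suc i))
         (R.*-congˡ {xvar 0} (elem-constant k k toℕ i)) ⟨
  C.elem k (weight (suc k) ∘ suc) (suc i) +ˢ xvar 0 *ˢ C.elem k (weight (suc k) ∘ suc) i
    ≈⟨ C.elem-suc k (weight (suc k)) i ⟨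
  C.elem (suc k) (weight (suc k)) (suc i) ∎
  where
  module R = CommutativeRing (seriesRing (suc k))
  module C = Colourings (seriesRing (suc k))
  module C⁻ = Colourings (seriesRing k)
  open SetoidReasoning R.setoid
  x*e : ∀ a α → (constant (e (suc i)) +ˢ xvar 0 *ˢ constant (e i)) (a ∷ α) ≡
    constant (e (suc i)) (a ∷ α) ℚ.+ shift 0 (constant (e i)) (a ∷ α)
  x*e a α = cong (constant (e (suc i)) (a ∷ α) ℚ.+_) (xvar-*ˢ 0 (constant (e i)) (a ∷ α))
  -- Exponent 0 of the first variable leaves e_{i+1} of the others, exponent 1 leaves e_i, and both
  -- sides vanish for larger exponents.
  e-suc : e (suc i) ≈[ suc k ] constant (e (suc i)) +ˢ xvar 0 *ˢ constant (e i)
  e-suc = slice-injective λ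
    { 0             → ≈ˢ⇒≈[] λ α → sym (trans (x*e 0 α) (ℚ.+-identityʳ _))
    ; 1             → ≈ˢ⇒≈[] λ α → sym (trans (x*e 1 α) (ℚ.+-identityˡ _))
    ; (suc (suc a)) → ≈ˢ⇒≈[] λ α → sym (trans (x*e (suc (suc a)) α) (ℚ.+-identityˡ _))
    }

-- Monomials of colourings and their exponents

get : List ℕ → ℕ → ℕ
get []      c       = 0
get (a ∷ α) zero    = a
get (a ∷ α) (suc c) = get α c

get-lookup : ∀ α (c : Fin (length α)) → get α (toℕ c) ≡ List.lookup α c
get-lookup (a ∷ α) zero    = refl
get-lookup (a ∷ α) (suc c) = get-lookup α c

decrement : ℕ → List ℕ → List ℕ
decrement c       []      = []
decrement zero    (a ∷ α) = pred a ∷ α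
decrement (suc c) (a ∷ α) = a ∷ decrement c α

length-decrement : ∀ c α → length (decrement c α) ≡ length α
length-decrement c       []      = refl
length-decrement zero    (a ∷ α) = refl
length-decrement (suc c) (a ∷ α) = cong suc (length-decrement c α)

get-decrement-≡ : ∀ c α → get (decrement c α) c ≡ pred (get α c)
get-decrement-≡ c       []      = refl
get-decrement-≡ zero    (a ∷ α) = refl
get-decrement-≡ (suc c) (a ∷ α) = get-decrement-≡ c α

get-decrement-≢ : ∀ c d α → c ≢ d → get (decrement c α) d ≡ get α d
get-decrement-≢ c       d       []      c≢d = refl
get-decrement-≢ zero    zero    (a ∷ α) c≢d = contradiction refl c≢d
get-decrement-≢ zero    (suc d) (a ∷ α) c≢d = refl
get-decrement-≢ (suc c) zero    (a ∷ α) c≢d = refl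
get-decrement-≢ (suc c) (suc d) (a ∷ α) c≢d = get-decrement-≢ c d α (c≢d ∘ cong suc)

shift-absent : ∀ c f α → get α c ≡ 0 → shift c f α ≡ 0ℚ
shift-absent c       f []         p = refl
shift-absent zero    f (zero ∷ α) p = refl
shift-absent (suc c) f (a ∷ α)    p = shift-absent c (slice f a) α p

shift-present : ∀ c f α {a} → get α c ≡ suc a → shift c f α ≡ f (decrement c α)
shift-present zero    f (suc a ∷ α) p = refl
shift-present (suc c) f (a ∷ α)     p = shift-present c (slice f a) α p

count-∷-≡ : ∀ {k n} (c : Fin k) (κ : Vec (Fin k) n) → count (c Fin.≟_) (c ∷ κ) ≡ suc (count (c Fin.≟_) κ)
count-∷-≡ c κ with c Fin.≟ c
... | yes _  = refl
... | no c≢c = contradiction refl c≢c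

count-∷-≢ : ∀ {k n} (c d : Fin k) (κ : Vec (Fin k) n) → d ≢ c → count (d Fin.≟_) (c ∷ κ) ≡ count (d Fin.≟_) κ
count-∷-≢ c d κ d≢c with d Fin.≟ c
... | yes d≡c = contradiction d≡c d≢c
... | no _    = refl

-- `HasContent` with the number of colours freed from `length α`: the induction below passes to
-- `decrement c α`, whose length is the same only propositionally.
Content : ∀ {k n} → List ℕ → Vec (Fin k) n → Set
Content {k} α κ = ∀ (c : Fin k) → count (c Fin.≟_) κ ≡ get α (toℕ c)

content? : ∀ {k n} α (κ : Vec (Fin k) n) → Dec (Content α κ)
content? α κ = Fin.all? λ c → count (c Fin.≟_) κ ℕ.≟ get α (toℕ c)

content-∷ : ∀ {k n} α c (κ : Vec (Fin k) n) {a} → get α (toℕ c) ≡ suc a →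
  Content (decrement (toℕ c) α) κ ⇔ Content α (c ∷ κ)
content-∷ {k} α c κ {a} eq = mk⇔ to from
  where
  to : Content (decrement (toℕ c) α) κ → Content α (c ∷ κ)
  to h d with d Fin.≟ c
  ... | yes refl = trans (cong suc (trans (h c) (trans (get-decrement-≡ (toℕ c) α) (cong pred eq)))) (sym eq)
  ... | no d≢c   = trans (h d) (get-decrement-≢ (toℕ c) (toℕ d) α (d≢c ∘ sym ∘ Fin.toℕ-injective))
  from : Content α (c ∷ κ) → Content (decrement (toℕ c) α) κ
  from h d with d Fin.≟ c
  ... | yes refl = trans (cong pred (trans (sym (count-∷-≡ c κ)) (h c))) (sym (get-decrement-≡ (toℕ c) α))
  ... | no d≢c   = trans (trans (sym (count-∷-≢ c d κ d≢c)) (h d))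
    (sym (get-decrement-≢ (toℕ c) (toℕ d) α (d≢c ∘ sym ∘ Fin.toℕ-injective)))

monomial : ∀ {k n} → Vec (Fin k) n → Series
monomial {k} = Colourings.mon (seriesRing k) (weight k)

-- A first vertex of colour `c` multiplies the monomial by x_c, so the exponent at `c` must be
-- positive and drops by one for the other vertices.
monomial-content : ∀ {k n} (κ : Vec (Fin k) n) α → length α ≡ k →
  monomial κ α ≡ ℚΣ.when (does (content? α κ)) 1ℚ
monomial-content [] α refl = cong (λ b → ℚΣ.when b 1ℚ)
  (does-⇔ (mk⇔ (λ h c → sym (to α h c)) (λ h → from α λ c → sym (h c))) (All.all? (ℕ._≟ 0) α) (content? α []))
  where
  to : ∀ α → All (_≡ 0) α → ∀ (c : Fin (length α)) → get α (toℕ c) ≡ 0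
  to (a ∷ α) (p ∷ h) zero    = p
  to (a ∷ α) (p ∷ h) (suc c) = to α h c
  from : ∀ α → (∀ (c : Fin (length α)) → get α (toℕ c) ≡ 0) → All (_≡ 0) α
  from []      h = []
  from (a ∷ α) h = h zero ∷ from α (h ∘ suc)
monomial-content (c ∷ κ) α p = trans (xvar-*ˢ (toℕ c) (monomial κ) α) (go (get α (toℕ c)) refl)
  where
  go : ∀ a → get α (toℕ c) ≡ a → shift (toℕ c) (monomial κ) α ≡ ℚΣ.when (does (content? α (c ∷ κ))) 1ℚ
  go zero eq = trans (shift-absent (toℕ c) (monomial κ) α eq)
    (sym (cong (λ b → ℚΣ.when b 1ℚ) (dec-false (content? α (c ∷ κ)) λ h →
      ℕ.1+n≢0 (trans (sym (count-∷-≡ c κ)) (trans (h c) eq)))))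
  go (suc a) eq = trans (shift-present (toℕ c) (monomial κ) α eq)
    (trans (monomial-content κ (decrement (toℕ c) α) (trans (length-decrement (toℕ c) α) p))
      (cong (λ b → ℚΣ.when b 1ℚ)
        (does-⇔ (content-∷ α c κ eq) (content? (decrement (toℕ c) α) κ) (content? α (c ∷ κ)))))

monomial-hasContent : ∀ {n} α (κ : Vec (Fin (length α)) n) →
  monomial κ α ≡ ℚΣ.when (does (hasContent? α κ)) 1ℚ
monomial-hasContent α κ = trans (monomial-content κ α refl) (cong (λ b → ℚΣ.when b 1ℚ)
  (does-⇔ (mk⇔ (λ h c → trans (h c) (get-lookup α c)) (λ h c → trans (h c) (sym (get-lookup α c))))
    (content? α κ) (hasContent? α κ)))

colSum-eval : ∀ k n (f : Vec (Fin k) n → Series) α →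
  FiniteSums.colSum (seriesRing k) n f α ≡ ℚΣ.colSum n (λ κ → f κ α)
colSum-eval k zero    f α = refl
colSum-eval k (suc n) f α = trans (Σᶠ-eval k _) (ℚΣ.Σᶠ-cong k λ c → colSum-eval k n (f ∘ (c ∷_)) α)
  where
  Σᶠ-eval : ∀ l (g : Fin l → Series) → FiniteSums.Σᶠ (seriesRing k) l g α ≡ ℚΣ.Σᶠ l (λ c → g c α)
  Σᶠ-eval zero    g = refl
  Σᶠ-eval (suc l) g = cong (g zero α ℚ.+_) (Σᶠ-eval l (g ∘ suc))

-- A colouring counts at α if it is proper and has content α; the second condition is the
-- coefficient of its monomial, which leaves properness to `ok`.
X-≈-colSum : ∀ {n} (H : Graph n) (ok : ∀ {k} → Vec (Fin k) n → Bool) →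
  (∀ {k} (κ : Vec (Fin k) n) → does (proper? H κ) ≡ ok κ) → ∀ k →
  X H ≈[ k ] FiniteSums.colSum (seriesRing k) {k} n (λ κ → FiniteSums.when (seriesRing k) (ok κ) (monomial κ))
X-≈-colSum {n} H ok p k = ⟨ (λ { α refl → trans (X-colSum H α) (sym (trans
  (colSum-eval k n _ α) (ℚΣ.colSum-cong n λ κ → pointwise α κ (proper? H κ) (ok κ) (p κ)))) }) ⟩
  where
  pointwise : ∀ α κ (d : Dec (Proper H κ)) b → does d ≡ b →
    FiniteSums.when (seriesRing (length α)) b (monomial κ) α ≡ ℚΣ.when (does d ∧ does (hasContent? α κ)) 1ℚ
  pointwise α κ d true  q rewrite q = monomial-hasContent α κ
  pointwise α κ d false q rewrite q = refl

-- Proper colourings of paths and their twins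

Starts : ∀ {k n} → Fin k → Vec (Fin k) n → Set
Starts c []      = ⊥
Starts c (d ∷ _) = c ≡ d

starts? : ∀ {k n} (c : Fin k) (κ : Vec (Fin k) n) → Dec (Starts c κ)
starts? c []      = no λ ()
starts? c (d ∷ _) = c Fin.≟ d

does-starts? : ∀ {k n} (c : Fin k) (κ : Vec (Fin k) n) → does (starts? c κ) ≡ starts c κ
does-starts? c []      = refl
does-starts? c (d ∷ _) = refl

-- The vertex `zero` has no neighbour but the next vertex, if there is one.
path-proper-∷ : ∀ {k n} (c : Fin k) (κ : Vec (Fin k) n) →
  Proper (path (suc n)) (c ∷ κ) ⇔ (¬ Starts c κ × Proper (path n) κ)
path-proper-∷ {k} c κ = mk⇔ (λ p → first κ p , λ u w → p (suc u) (suc w) ∘ Sum.map (cong suc) (cong suc))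
                      (λ (s , p) → λ { zero    zero    → λ { (inj₁ ()) ; (inj₂ ()) }
                                     ; zero    (suc w) → second κ s w
                                     ; (suc u) zero    → λ a → second κ s u (Sum.swap a) ∘ sym
                                     ; (suc u) (suc w) → p u w ∘ Sum.map ℕ.suc-injective ℕ.suc-injective })
  where
  first : ∀ {n} (κ : Vec (Fin k) n) → Proper (path (suc n)) (c ∷ κ) → ¬ Starts c κ
  first (d ∷ κ) p = p zero (suc zero) (inj₁ refl)
  second : ∀ {n} (κ : Vec (Fin k) n) → ¬ Starts c κ → ∀ w →
    1 ≡ suc (toℕ w) ⊎ suc (suc (toℕ w)) ≡ 0 → c ≢ lookup κ w
  second (d ∷ κ) s zero    a = s
  second (d ∷ κ) s (suc w) (inj₁ ())
  second (d ∷ κ) s (suc w) (inj₂ ())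

does-path-proper? : ∀ {k n} (κ : Vec (Fin k) n) → does (proper? (path n) κ) ≡ pathOk κ
does-path-proper? {n = zero}  []      = refl
does-path-proper? {n = suc n} (c ∷ κ) = trans
  (does-⇔ (path-proper-∷ c κ) (proper? (path (suc n)) (c ∷ κ)) (¬? (starts? c κ) ×-dec proper? (path n) κ))
  (cong₂ (λ s p → not s ∧ p) (does-starts? c κ) (does-path-proper? κ))

-- The new vertex, coloured `c`, is joined to the end vertex, coloured `d`, and to the only possible
-- neighbour of that, the head of `κ`.
twin-proper-∷ : ∀ {k m} (c d : Fin k) (κ : Vec (Fin k) m) →
  Proper (twin (path (suc m)) zero) (c ∷ d ∷ κ) ⇔ (c ≢ d × (¬ Starts c κ × Proper (path (suc m)) (d ∷ κ)))
twin-proper-∷ {k} c d κ = mk⇔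
  (λ p → p zero (suc zero) (inj₁ refl) , first κ p , λ u w → p (suc u) (suc w))
  (λ (c≢d , s , p) → λ { zero    (suc w) → second κ c≢d s w
                       ; (suc u) zero    → λ a → second κ c≢d s u a ∘ sym
                       ; (suc u) (suc w) → p u w })
  where
  first : ∀ {m} (κ : Vec (Fin k) m) → Proper (twin (path (suc m)) zero) (c ∷ d ∷ κ) → ¬ Starts c κ
  first (f ∷ κ) p = p zero (suc (suc zero)) (inj₂ (inj₁ refl))
  second : ∀ {m} (κ : Vec (Fin k) m) → c ≢ d → ¬ Starts c κ → ∀ w →
    TwinAdj (path (suc m)) zero zero (suc w) → c ≢ lookup (d ∷ κ) w
  second κ       c≢d s zero          a = c≢d
  second (f ∷ κ) c≢d s (suc zero)    a = s
  second (f ∷ κ) c≢d s (suc (suc w)) (inj₁ ())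
  second (f ∷ κ) c≢d s (suc (suc w)) (inj₂ (inj₁ ()))
  second (f ∷ κ) c≢d s (suc (suc w)) (inj₂ (inj₂ ()))

does-twin-proper? : ∀ {k m} (κ : Vec (Fin k) (suc (suc m))) →
  does (proper? (twin (path (suc m)) zero) κ) ≡ twinOk κ
does-twin-proper? {m = m} (c ∷ d ∷ κ) = trans
  (does-⇔ (twin-proper-∷ c d κ) (proper? (twin (path (suc m)) zero) (c ∷ d ∷ κ))
    (¬? (c Fin.≟ d) ×-dec (¬? (starts? c κ) ×-dec proper? (path (suc m)) (d ∷ κ))))
  (cong₂ (λ s p → not (does (c Fin.≟ d)) ∧ (not s ∧ p)) (does-starts? c κ) (does-path-proper? (d ∷ κ)))

lookup-∷ʳ-fromℕ : ∀ {A : Set} {n} (xs : Vec A n) x → lookup (xs ∷ʳ x) (fromℕ n) ≡ x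
lookup-∷ʳ-fromℕ []       x = refl
lookup-∷ʳ-fromℕ (y ∷ xs) x = lookup-∷ʳ-fromℕ xs x

lookup-∷ʳ-inject₁ : ∀ {A : Set} {n} (xs : Vec A n) x i → lookup (xs ∷ʳ x) (inject₁ i) ≡ lookup xs i
lookup-∷ʳ-inject₁ (y ∷ xs) x zero    = refl
lookup-∷ʳ-inject₁ (y ∷ xs) x (suc i) = lookup-∷ʳ-inject₁ xs x i

lookup-reverse-opposite : ∀ {A : Set} {n} (xs : Vec A n) i → lookup (reverse xs) (opposite i) ≡ lookup xs i
lookup-reverse-opposite (x ∷ xs) zero    =
  trans (cong (λ ys → lookup ys (fromℕ _)) (reverse-∷ x xs)) (lookup-∷ʳ-fromℕ (reverse xs) x)
lookup-reverse-opposite (x ∷ xs) (suc i) =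
  trans (cong (λ ys → lookup ys (inject₁ (opposite i))) (reverse-∷ x xs))
    (trans (lookup-∷ʳ-inject₁ (reverse xs) x (opposite i)) (lookup-reverse-opposite xs i))

module _ {A : Set} {P : A → Set} (P? : Decidable P) where
  count-∷ʳ : ∀ {n} (xs : Vec A n) x → count P? (xs ∷ʳ x) ≡ count P? (x ∷ xs)
  count-∷ʳ []       x = refl
  count-∷ʳ (y ∷ xs) x rewrite count-∷ʳ xs x with does (P? x) | does (P? y)
  ... | true  | true  = refl
  ... | true  | false = refl
  ... | false | true  = refl
  ... | false | false = refl

  count-reverse : ∀ {n} (xs : Vec A n) → count P? (reverse xs) ≡ count P? xs
  count-reverse []       = refl
  count-reverse (x ∷ xs) = trans (cong (count P?) (reverse-∷ x xs))
    (trans (count-∷ʳ (reverse xs) x) (cong (if does (P? x) then suc else id) (count-reverse xs)))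

path-adj-opposite : ∀ {n} (u w : Fin n) → Graph.Adj (path n) u w → Graph.Adj (path n) (opposite u) (opposite w)
path-adj-opposite {n} u w = Sum.swap ∘ Sum.map (step u w) (step w u)
  where
  step : ∀ (u w : Fin n) → suc (toℕ u) ≡ toℕ w → suc (toℕ (opposite w)) ≡ toℕ (opposite u)
  step u w p = begin
    suc (toℕ (opposite w))   ≡⟨ cong suc (Fin.opposite-prop w) ⟩
    suc (n ∸ suc (toℕ w))    ≡⟨ ℕ.+-∸-assoc 1 (Fin.toℕ<n w) ⟨
    n ∸ toℕ w                ≡⟨ cong (n ∸_) p ⟨
    n ∸ suc (toℕ u)          ≡⟨ Fin.opposite-prop u ⟨
    toℕ (opposite u)         ∎
    where open ≡-Reasoning

-- Reversing the path and fixing the new vertex preserves adjacency. One implication is enough: its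
-- instance at `opposite v` and `reverse κ` is the converse, reversal being an involution.
twin-proper-reverse : ∀ {k n} (v : Fin n) (c : Fin k) κ →
  Proper (twin (path n) (opposite v)) (c ∷ reverse κ) → Proper (twin (path n) v) (c ∷ κ)
twin-proper-reverse {n = n} v c κ p u w a q = p (σ u) (σ w) (σ-adj u w a)
  (trans (lookup-σ u) (trans q (sym (lookup-σ w))))
  where
  σ : Fin (suc n) → Fin (suc n)
  σ zero    = zero
  σ (suc i) = suc (opposite i)
  lookup-σ : ∀ i → lookup (c ∷ reverse κ) (σ i) ≡ lookup (c ∷ κ) i
  lookup-σ zero    = refl
  lookup-σ (suc i) = lookup-reverse-opposite κ i
  σ-adj : ∀ u w → TwinAdj (path n) v u w → TwinAdj (path n) (opposite v) (σ u) (σ w)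
  σ-adj zero    (suc w) = Sum.map (cong opposite) (path-adj-opposite v w)
  σ-adj (suc u) zero    = Sum.map (cong opposite) (path-adj-opposite v u)
  σ-adj (suc u) (suc w) = path-adj-opposite u w

X-twin-opposite : ∀ {n} (v : Fin n) → X (twin (path n) v) ≈ˢ X (twin (path n) (opposite v))
X-twin-opposite {n} v α = trans (X-colSum (twin (path n) v) α) (trans
  (ℚΣ.Σᶠ-cong k λ c → trans
    (ℚΣ.colSum-cong n λ κ → cong₂ (λ b b′ → ℚΣ.when (b ∧ b′) 1ℚ)
      (does-⇔ (mk⇔ (there c κ) (twin-proper-reverse v c κ)) (proper? (twin (path n) v) (c ∷ κ))
        (proper? (twin (path n) (opposite v)) (c ∷ reverse κ)))
      (does-⇔ (mk⇔ (λ h d → trans (counts c d κ) (h d)) (λ h d → trans (sym (counts c d κ)) (h d)))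
        (hasContent? α (c ∷ κ)) (hasContent? α (c ∷ reverse κ))))
    (ℚΣ.colSum-reverse n λ κ → ℚΣ.when
      (does (proper? (twin (path n) (opposite v)) (c ∷ κ)) ∧ does (hasContent? α (c ∷ κ))) 1ℚ))
  (sym (X-colSum (twin (path n) (opposite v)) α)))
  where
  k = length α
  there : ∀ c κ → Proper (twin (path n) v) (c ∷ κ) → Proper (twin (path n) (opposite v)) (c ∷ reverse κ)
  there c κ p = twin-proper-reverse (opposite v) c (reverse κ)
    (subst₂ (λ u μ → Proper (twin (path n) u) (c ∷ μ)) (sym (Fin.opposite-involutive v)) (sym (reverse-involutive κ)) p)
  counts : ∀ c d (κ : Vec (Fin k) n) → count (d Fin.≟_) (c ∷ reverse κ) ≡ count (d Fin.≟_) (c ∷ κ)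
  counts c d κ = cong (if does (d Fin.≟ c) then suc else id) (count-reverse (d Fin.≟_) κ)

-- The last vertex is `opposite zero`, so the symmetry of the path reduces both ends to the vertex
-- `zero`.
X-twin-end : ∀ {m} (v : Fin (suc m)) → IsEndVertex v → X (twin (path (suc m)) v) ≈ˢ X (twin (path (suc m)) zero)
X-twin-end zero    (inj₁ _) α = refl
X-twin-end {m} v   (inj₂ p) α = trans
  (cong (λ u → X (twin (path (suc m)) u) α) v≡opp)
  (trans (X-twin-opposite (opposite zero) α)
    (cong (λ u → X (twin (path (suc m)) u) α) (Fin.opposite-involutive {suc m} zero)))
  where
  v≡opp : v ≡ opposite zero
  v≡opp = Fin.toℕ-injective (trans (ℕ.suc-injective p) (sym (Fin.toℕ-fromℕ m)))

-- Generating functions in k variables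

module InVariables (k : ℕ) where
  module R = CommutativeRing (seriesRing k)
  open R using () renaming (_≈_ to _≈ₖ_)
  open PowerSeries (seriesRing k)
  module S = CommutativeRing powerSeries
  module C = Colourings (seriesRing k)
  open SemiringMult R.semiring using (×-congʳ) renaming (_×_ to _·_)
  open Identities (seriesRing k)
  open SetoidReasoning R.setoid

  ⋆≈· : ∀ n f → n ⋆ f ≈ₖ n · f
  ⋆≈· zero    f = ≈ˢ⇒≈[] (0⋆ f)
  ⋆≈· (suc n) f = R.trans (≈ˢ⇒≈[] (⋆-suc n f)) (R.+-congˡ {f} (⋆≈· n f))

  X-path : 𝒳-P ≋ C.pathSum (weight k)
  X-path n = X-≈-colSum (path n) pathOk does-path-proper? k

  -- The cutoff at 2 in `G` needs no separate treatment on the right, because the factor `n ∸ 1`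
  -- vanishes in degrees 0 and 1.
  G-elem : G ≋ λ n → (n ∸ 1) · C.elem k (weight k) n
  G-elem 0             = R.refl
  G-elem 1             = R.refl
  G-elem (suc (suc n)) = R.trans (⋆≈· (suc n) (e (suc (suc n)))) (×-congʳ (suc n) (e-≈-elem k (suc (suc n))))

  𝒳-P-≋ : 𝒳-P ≋ e ⊕ G ⊛ 𝒳-P
  𝒳-P-≋ = S.trans X-path (S.trans (C.pathSum-≋ (weight k))
    (S.sym (S.+-cong {e} (e-≈-elem k) (S.*-cong {G} G-elem X-path))))

  X-path-0 : X (path 0) ≈ₖ 1ˢ
  X-path-0 = X-path 0

  X-path-1 : X (path 1) ≈ₖ e 1
  X-path-1 = R.trans (𝒳-P-≋ 1) (pathValue₁ (e 1) (X (path 0)) (X (path 1)))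

  X-path-2 : X (path 2) ≈ₖ 2 · e 2
  X-path-2 = R.trans (𝒳-P-≋ 2) (R.trans
    (R.+-congˡ {e 2} (R.+-congˡ {0ˢ *ˢ X (path 2)} (R.+-congˡ {0ˢ *ˢ X (path 1)} (R.+-congʳ {0ˢ}
      (R.*-congʳ {X (path 0)} (⋆≈· 1 (e 2)))))))
    (pathValue₂ (e 2) (X (path 1)) (X (path 2)) X-path-0))

  z²-⊛ : ∀ f H m → ((f z^ 2) ⊛ H) (suc (suc m)) ≈ₖ f *ˢ H m
  z²-⊛ f H m = begin
    ((f z^ 2) ⊛ H) (suc (suc m))                 ≈⟨ ⊛-suc (f z^ 2) H (suc m) ⟩
    0ˢ *ˢ H (suc (suc m)) +ˢ (((f z^ 2) ∘ suc) ⊛ H) (suc m)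
      ≈⟨ R.trans (R.+-congʳ (R.zeroˡ (H (suc (suc m))))) (R.+-identityˡ _) ⟩
    (((f z^ 2) ∘ suc) ⊛ H) (suc m)               ≈⟨ ⊛-cong {G = H} z≋lin (λ _ → R.refl) (suc m) ⟩
    (C.lin f ⊛ H) (suc m)                        ≈⟨ C.lin-⊛-suc f H m ⟩
    f *ˢ H m                                     ∎
    where
    z≋lin : (f z^ 2) ∘ suc ≋ C.lin f
    z≋lin 0             = R.refl
    z≋lin 1             = R.refl
    z≋lin (suc (suc n)) = R.refl

  G-split : G ≋ (e 2 z^ 2) ⊕ G≥ 3
  G-split 0                   = R.sym (R.+-identityˡ 0ˢ)
  G-split 1                   = R.sym (R.+-identityˡ 0ˢ)
  G-split 2                   = R.trans (⋆≈· 1 (e 2)) R.refl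
  G-split (suc (suc (suc n))) = R.sym (R.+-identityˡ _)

  -- The z² term of `G` contributes exactly the product with `e 2` that the formula for the twin
  -- subtracts. What remains of `G` starts in degree 3, which is how `G≥ 3` arises.
  X-path-𝒴 : ∀ m → X (path (suc (suc m))) ≈ₖ 𝒴 (suc (suc m)) +ˢ e 2 *ˢ X (path m)
  X-path-𝒴 m = begin
    X (path (suc (suc m)))
      ≈⟨ 𝒳-P-≋ (suc (suc m)) ⟩
    e (suc (suc m)) +ˢ (G ⊛ 𝒳-P) (suc (suc m))
      ≈⟨ R.+-congˡ {e (suc (suc m))} (R.trans (⊛-cong {G = 𝒳-P} G-split (λ _ → R.refl) (suc (suc m)))
           (⊛-distribʳ 𝒳-P (e 2 z^ 2) (G≥ 3) (suc (suc m)))) ⟩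
    e (suc (suc m)) +ˢ (((e 2 z^ 2) ⊛ 𝒳-P) (suc (suc m)) +ˢ (G≥ 3 ⊛ 𝒳-P) (suc (suc m)))
      ≈⟨ R.+-congˡ {e (suc (suc m))} (R.+-cong (z²-⊛ (e 2) 𝒳-P m) (⊛-comm (G≥ 3) 𝒳-P (suc (suc m)))) ⟩
    e (suc (suc m)) +ˢ (e 2 *ˢ X (path m) +ˢ (𝒳-P ⊛ G≥ 3) (suc (suc m)))
      ≈⟨ rotate (e (suc (suc m))) (e 2 *ˢ X (path m)) ((𝒳-P ⊛ G≥ 3) (suc (suc m))) ⟩
    𝒴 (suc (suc m)) +ˢ e 2 *ˢ X (path m) ∎
    where
    rotate : ∀ x y z → x +ˢ (y +ˢ z) ≈ₖ (z +ˢ x) +ˢ y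
    rotate x y z = R.trans (R.sym (R.+-assoc x y z)) (R.trans (R.+-comm (x +ˢ y) z) (R.sym (R.+-assoc z x y)))

  X-twin-double : ∀ m → X (twin (path (suc m)) zero) ≈ₖ 𝒴 (suc (suc m)) +ˢ 𝒴 (suc (suc m))
  X-twin-double m = double-cancel {p = X (path m)} {q = e 2} {s = 𝒴 (suc (suc m))} (begin
    X (twin (path (suc m)) zero) +ˢ (e 2 +ˢ e 2) *ˢ X (path m)
      ≈⟨ R.+-cong (X-≈-colSum (twin (path (suc m)) zero) twinOk does-twin-proper? k)
           (R.*-cong (R.+-cong (e-≈-elem k 2) (e-≈-elem k 2)) (X-path m)) ⟩
    C.twinSum w m +ˢ (C.elem k w 2 +ˢ C.elem k w 2) *ˢ C.pathSum w m
      ≈⟨ C.twinSum-≈ w m ⟩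
    C.pathSum w (suc (suc m)) +ˢ C.pathSum w (suc (suc m))
      ≈⟨ R.+-cong (X-path (suc (suc m))) (X-path (suc (suc m))) ⟨
    X (path (suc (suc m))) +ˢ X (path (suc (suc m)))
      ≈⟨ R.+-cong (X-path-𝒴 m) (X-path-𝒴 m) ⟩
    (𝒴 (suc (suc m)) +ˢ e 2 *ˢ X (path m)) +ˢ (𝒴 (suc (suc m)) +ˢ e 2 *ˢ X (path m)) ∎)
    where w = weight k

  𝒴-0 : 𝒴 0 ≈ₖ 0ˢ
  𝒴-0 = R.trans (R.+-identityʳ _) (R.trans (⊛-zero 𝒳-P (G≥ 3)) (R.zeroʳ (X (path 0))))

  𝒴-1 : 𝒴 1 ≈ₖ 0ˢ
  𝒴-1 = R.trans (R.+-identityʳ _) (R.trans (⊛-suc 𝒳-P (G≥ 3) 0) (R.trans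
    (R.+-cong (R.zeroʳ (X (path 0))) (R.trans (⊛-zero (𝒳-P ∘ suc) (G≥ 3)) (R.zeroʳ (X (path 1)))))
    (R.+-identityˡ 0ˢ)))

  1ᶻ≋𝟙 : 1ᶻ ≋ 𝟙
  1ᶻ≋𝟙 zero    = R.refl
  1ᶻ≋𝟙 (suc n) = R.refl

  D⊕G : D ⊕ G ≋ 𝟙
  D⊕G n = R.trans (R.+-assoc (1ᶻ n) (-ˢ G n) (G n))
    (R.trans (R.+-congˡ {1ᶻ n} (R.-‿inverseˡ (G n))) (R.trans (R.+-identityʳ (1ᶻ n)) (1ᶻ≋𝟙 n)))

  -- D + G = 1 is multiplied by `recip D`; this makes `recip D` the Q of `quotientForm`.
  recip-D : recip D ≋ 𝟙 ⊕ G ⊛ recip D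
  recip-D = S.trans (S.sym (S.*-identityˡ (recip D)))
    (S.trans (S.*-congʳ {recip D} (S.sym D⊕G))
      (S.trans (S.distribʳ (recip D) D G)
        (S.+-congʳ {G ⊛ recip D} (S.trans (λ n → ≈ˢ⇒≈[] (*ᶻ-inverse D D-constant n)) 1ᶻ≋𝟙))))

  -- As eᵢ + (i - 1) eᵢ = i eᵢ, the sum is `K` from degree 2 on; 1 and e₁z are what lies below.
  e⊕G : e ⊕ G ≋ 𝟙 ⊕ K ⊕ (e 1 z^ 1)
  e⊕G 0 = R.trans (R.+-identityʳ (e 0)) (R.trans (≈ˢ⇒≈[] e-0)
    (R.sym (R.trans (R.+-identityʳ _) (R.+-identityʳ 1ˢ))))
  e⊕G 1 = R.trans (R.+-comm (e 1) 0ˢ) (R.+-congʳ {e 1} (R.sym (R.+-identityˡ 0ˢ)))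
  e⊕G (suc (suc n)) = R.trans (R.sym (≈ˢ⇒≈[] (⋆-suc (suc n) (e (suc (suc n))))))
    (R.sym (R.trans (R.+-identityʳ _) (R.+-identityˡ _)))

  -- The same addition, but `G≥ 3` is still zero in degree 2, so that e₂z² keeps the coefficient 1.
  G₃⊕e : G≥ 3 ⊕ ∑≥ 2 e ≋ (e 2 z^ 2) ⊕ ∑≥ 3 (λ i → i ⋆ e i)
  G₃⊕e 0 = R.refl
  G₃⊕e 1 = R.refl
  G₃⊕e 2 = R.+-comm 0ˢ (e 2)
  G₃⊕e (suc (suc (suc n))) = R.trans (R.+-comm (suc (suc n) ⋆ e (3 ℕ.+ n)) (e (3 ℕ.+ n)))
    (R.trans (R.sym (≈ˢ⇒≈[] (⋆-suc (suc (suc n)) (e (3 ℕ.+ n))))) (R.sym (R.+-identityˡ _)))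

  𝒴-quotientForm : 𝒴 ≋ K *ᶻ (G≥ 3 /ᶻ D) +ᶻ (e 1 z^ 1) *ᶻ G *ᶻ (G≥ 3 /ᶻ D) +ᶻ e 2 z^ 2
        +ᶻ ∑≥ 3 (λ i → i ⋆ e i) +ᶻ (e 1 z^ 1) *ᶻ G≥ 3
  𝒴-quotientForm = Identities.quotientForm powerSeries {𝒳-P} {e} {G} {recip D} 𝒳-P-≋ recip-D
    {G≥ 3} {∑≥ 2 e} {K} {e 1 z^ 1} {e 2 z^ 2} {∑≥ 3 (λ i → i ⋆ e i)} e⊕G G₃⊕e

  𝒴-2 : 𝒴 2 ≈ₖ e 2
  𝒴-2 = value₂ (X (path 0)) (X (path 1)) (X (path 2)) (e 2)

  *⋆≈· : ∀ f n g → f *ˢ (n ⋆ g) ≈ₖ f *ˢ (n · g)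
  *⋆≈· f n g = R.*-congˡ {f} (⋆≈· n g)

  𝒴-3 : 𝒴 3 ≈ₖ 3 ⋆ e 3
  𝒴-3 = R.trans (R.+-congʳ (R.+-congʳ (*⋆≈· (X (path 0)) 2 (e 3))))
    (R.trans (value₃ (X (path 1)) (X (path 2)) (X (path 3)) (e 3) X-path-0) (R.sym (⋆≈· 3 (e 3))))

  𝒴-4 : 𝒴 4 ≈ₖ 4 ⋆ e 4 +ˢ 2 ⋆ (e 1 *ˢ e 3)
  𝒴-4 = R.trans
    (R.+-congʳ (R.+-cong (*⋆≈· (X (path 0)) 3 (e 4)) (R.+-congʳ (*⋆≈· (X (path 1)) 2 (e 3)))))
    (R.trans (value₄ (X (path 2)) (X (path 3)) (X (path 4)) (e 3) (e 4) X-path-0 X-path-1)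
      (R.sym (R.+-cong (⋆≈· 4 (e 4)) (⋆≈· 2 (e 1 *ˢ e 3)))))

  𝒴-5 : 𝒴 5 ≈ₖ 4 ⋆ (e 2 *ˢ e 3) +ˢ 3 ⋆ (e 1 *ˢ e 4) +ˢ 5 ⋆ e 5
  𝒴-5 = R.trans
    (R.+-congʳ (R.+-cong (*⋆≈· (X (path 0)) 4 (e 5)) (R.+-cong (*⋆≈· (X (path 1)) 3 (e 4))
      (R.+-congʳ (*⋆≈· (X (path 2)) 2 (e 3))))))
    (R.trans (value₅ {e₂ = e 2} (X (path 3)) (X (path 4)) (X (path 5)) (e 3) (e 4) (e 5) X-path-0 X-path-1 X-path-2)
      (R.sym (R.+-cong (R.+-cong (⋆≈· 4 (e 2 *ˢ e 3)) (⋆≈· 3 (e 1 *ˢ e 4))) (⋆≈· 5 (e 5)))))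

-- Expansions in the elementary basis

*ˢ-congˡ : ∀ f {g h} → g ≈ˢ h → f *ˢ g ≈ˢ f *ˢ h
*ˢ-congˡ f p α = sumℚ-cong (splits α) λ (β , γ) → cong (f β ℚ.*_) (p γ)

*ˢ-comm : ∀ f g → f *ˢ g ≈ˢ g *ˢ f
*ˢ-comm f g = ≈[]⇒≈ˢ λ k → CommutativeRing.*-comm (seriesRing k) f g

*ˢ-zeroʳ : ∀ f → f *ˢ 0ˢ ≈ˢ 0ˢ
*ˢ-zeroʳ f = ≈[]⇒≈ˢ λ k → CommutativeRing.zeroʳ (seriesRing k) f

*ˢ-zeroˡ : ∀ f → 0ˢ *ˢ f ≈ˢ 0ˢ
*ˢ-zeroˡ f = ≈[]⇒≈ˢ λ k → CommutativeRing.zeroˡ (seriesRing k) f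

*ˢ-distribˡ : ∀ f g h → f *ˢ (g +ˢ h) ≈ˢ f *ˢ g +ˢ f *ˢ h
*ˢ-distribˡ f g h = ≈[]⇒≈ˢ λ k → CommutativeRing.distribˡ (seriesRing k) f g h

*ˢ-assoc : ∀ f g h → (f *ˢ g) *ˢ h ≈ˢ f *ˢ (g *ˢ h)
*ˢ-assoc f g h = ≈[]⇒≈ˢ λ k → CommutativeRing.*-assoc (seriesRing k) f g h

*ˢ-left-comm : ∀ f g h → f *ˢ (g *ˢ h) ≈ˢ g *ˢ (f *ˢ h)
*ˢ-left-comm f g h α = trans (sym (*ˢ-assoc f g h α)) (trans
  (sumℚ-cong (splits α) λ (β , γ) → cong (ℚ._* h γ) (*ˢ-comm f g β))
  (*ˢ-assoc g f h α))

sumℚ-*ˡ : ∀ {A : Set} c (xs : List A) f → sumℚ xs (λ x → c ℚ.* f x) ≡ c ℚ.* sumℚ xs f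
sumℚ-*ˡ c []       f = sym (ℚ.*-zeroʳ c)
sumℚ-*ˡ c (x ∷ xs) f = trans (cong (c ℚ.* f x ℚ.+_) (sumℚ-*ˡ c xs f)) (sym (ℚ.*-distribˡ-+ c _ _))

*ˢ-•ˢ : ∀ c f g → f *ˢ (c •ˢ g) ≈ˢ c •ˢ (f *ˢ g)
*ˢ-•ˢ c f g α = trans
  (sumℚ-cong (splits α) λ (β , γ) →
    trans (sym (ℚ.*-assoc (f β) c (g γ))) (trans (cong (ℚ._* g γ) (ℚ.*-comm (f β) c)) (ℚ.*-assoc c (f β) (g γ))))
  (sumℚ-*ˡ c (splits α) λ (β , γ) → f β ℚ.* g γ)

e[]-↭ : ∀ {λs μs} → λs ↭ μs → e[ λs ] ≈ˢ e[ μs ]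
e[]-↭ Perm.refl         α = refl
e[]-↭ (Perm.prep i p)     = *ˢ-congˡ (e i) (e[]-↭ p)
e[]-↭ (Perm.swap {xs = λs} i j p) α = trans (*ˢ-left-comm (e i) (e j) e[ λs ] α)
  (*ˢ-congˡ (e j) (*ˢ-congˡ (e i) (e[]-↭ p)) α)
e[]-↭ (Perm.trans p q)  α = trans (e[]-↭ p α) (e[]-↭ q α)

Term : Set
Term = ℚ × List ℕ

⟦_⟧ : Term → Series
⟦ c , λs ⟧ = c •ˢ e[ λs ]

open CommutativeSemigroupProperties (CommutativeRing.+-commutativeSemigroup ℚ.+-*-commutativeRing) using (x∙yz≈y∙xz)

-- Coefficients of equal indices are added, so that no index is ever repeated, as `distinct`
-- demands.
insertTerm : ℚ → List ℕ → List Term → List Term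
insertTerm c μ []             = (c , μ) ∷ []
insertTerm c μ ((d , ν) ∷ ts) with ≡-dec ℕ._≟_ μ ν
... | yes _ = (c ℚ.+ d , ν) ∷ ts
... | no  _ = (d , ν) ∷ insertTerm c μ ts

insertTerm-index : ∀ {P : List ℕ → Set} c {μ} ts → P μ → All (P ∘ proj₂) ts → All (P ∘ proj₂) (insertTerm c μ ts)
insertTerm-index c     []             p []       = p ∷ []
insertTerm-index c {μ} ((d , ν) ∷ ts) p (q ∷ qs) with ≡-dec ℕ._≟_ μ ν
... | yes _ = q ∷ qs
... | no  _ = q ∷ insertTerm-index c ts p qs

insertTerm-nonNeg : ∀ {c} μ ts → 0ℚ ℚ.≤ c → All ((0ℚ ℚ.≤_) ∘ proj₁) ts → All ((0ℚ ℚ.≤_) ∘ proj₁) (insertTerm c μ ts)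
insertTerm-nonNeg μ []             p []       = p ∷ []
insertTerm-nonNeg μ ((d , ν) ∷ ts) p (q ∷ qs) with ≡-dec ℕ._≟_ μ ν
... | yes _ = ℚ.+-mono-≤ p q ∷ qs
... | no  _ = q ∷ insertTerm-nonNeg μ ts p qs

insertTerm-distinct : ∀ c μ ts → AllPairs (_≢_ on proj₂) ts → AllPairs (_≢_ on proj₂) (insertTerm c μ ts)
insertTerm-distinct c μ []             []       = [] ∷ []
insertTerm-distinct c μ ((d , ν) ∷ ts) (q ∷ qs) with ≡-dec ℕ._≟_ μ ν
... | yes _  = q ∷ qs
... | no μ≢ν = insertTerm-index {ν ≢_} c ts (μ≢ν ∘ sym) q ∷ insertTerm-distinct c μ ts qs

insertTerm-sum : ∀ c μ ts → sumˢ (insertTerm c μ ts) ⟦_⟧ ≈ˢ ⟦ c , μ ⟧ +ˢ sumˢ ts ⟦_⟧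
insertTerm-sum c μ []             α = refl
insertTerm-sum c μ ((d , ν) ∷ ts) α with ≡-dec ℕ._≟_ μ ν
... | yes refl = trans (cong (ℚ._+ sumˢ ts ⟦_⟧ α) (ℚ.*-distribʳ-+ (e[ ν ] α) c d))
  (ℚ.+-assoc (⟦ c , ν ⟧ α) (⟦ d , ν ⟧ α) (sumˢ ts ⟦_⟧ α))
... | no  _    = trans (cong (⟦ d , ν ⟧ α ℚ.+_) (insertTerm-sum c μ ts α))
  (x∙yz≈y∙xz (⟦ d , ν ⟧ α) (⟦ c , μ ⟧ α) (sumˢ ts ⟦_⟧ α))

-- Sorts the indices into partitions and merges equal ones. Coefficients are only ever added, so
-- they stay nonnegative.
collect : List Term → List Term
collect []              = []
collect ((c , λs) ∷ ts) = insertTerm c (sort λs) (collect ts)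

NonNegTerm : Term → Set
NonNegTerm (c , λs) = 0ℚ ℚ.≤ c × All (0 ℕ.<_) λs

-- Unlike in EPositive, the indices need not be sorted or distinct.
NonNegSum : Series → Set
NonNegSum f = Σ[ ts ∈ List Term ] All NonNegTerm ts × f ≈ˢ sumˢ ts ⟦_⟧

sort-partition : ∀ {λs} → All (0 ℕ.<_) λs → IsPartition (sort λs)
sort-partition {λs} p = record { positive = All-resp-↭ (↭-sym (sort-↭ λs)) p ; decreasing = sort-↗ λs }

collect-partition : ∀ {ts} → All NonNegTerm ts → All (IsPartition ∘ proj₂) (collect ts)
collect-partition []                        = []
collect-partition {(c , _) ∷ ts} (p ∷ ps) = insertTerm-index c (collect ts) (sort-partition (proj₂ p)) (collect-partition ps)

collect-nonNeg : ∀ {ts} → All NonNegTerm ts → All ((0ℚ ℚ.≤_) ∘ proj₁) (collect ts)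
collect-nonNeg []                         = []
collect-nonNeg {(_ , λs) ∷ ts} (p ∷ ps) = insertTerm-nonNeg (sort λs) (collect ts) (proj₁ p) (collect-nonNeg ps)

collect-distinct : ∀ ts → AllPairs (_≢_ on proj₂) (collect ts)
collect-distinct []              = []
collect-distinct ((c , λs) ∷ ts) = insertTerm-distinct c (sort λs) (collect ts) (collect-distinct ts)

collect-sum : ∀ ts → sumˢ (collect ts) ⟦_⟧ ≈ˢ sumˢ ts ⟦_⟧
collect-sum []              α = refl
collect-sum ((c , λs) ∷ ts) α = trans (insertTerm-sum c (sort λs) (collect ts) α)
  (cong₂ ℚ._+_ (cong (c ℚ.*_) (e[]-↭ (sort-↭ λs) α)) (collect-sum ts α))

NonNegSum⇒EPositive : ∀ {f} → NonNegSum f → EPositive f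
NonNegSum⇒EPositive (ts , ps , eq) = record
  { terms      = collect ts
  ; partitions = collect-partition ps
  ; distinct   = AllPairs.map⁺ (collect-distinct ts)
  ; expands    = λ α → trans (eq α) (sym (collect-sum ts α))
  } , collect-nonNeg ps

nonNeg-cong : ∀ {f g} → f ≈ˢ g → NonNegSum g → NonNegSum f
nonNeg-cong p (ts , ps , eq) = ts , ps , λ α → trans (p α) (eq α)

nonNeg-0 : NonNegSum 0ˢ
nonNeg-0 = [] , [] , λ α → refl

nonNeg-1 : NonNegSum 1ˢ
nonNeg-1 = (1ℚ , []) ∷ [] , (ℚ.nonNegative⁻¹ 1ℚ , []) ∷ [] ,
  λ α → sym (trans (ℚ.+-identityʳ _) (ℚ.*-identityˡ (1ˢ α)))

nonNeg-+ : ∀ {f g} → NonNegSum f → NonNegSum g → NonNegSum (f +ˢ g)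
nonNeg-+ (ts , ps , p) (us , qs , q) = ts ++ us , All.++⁺ ps qs , λ α → trans (cong₂ ℚ._+_ (p α) (q α)) (sum-++ ts α)
  where
  sum-++ : ∀ ts α → sumˢ ts ⟦_⟧ α ℚ.+ sumˢ us ⟦_⟧ α ≡ sumˢ (ts ++ us) ⟦_⟧ α
  sum-++ []       α = ℚ.+-identityˡ _
  sum-++ (t ∷ ts) α = trans (ℚ.+-assoc (⟦ t ⟧ α) _ _) (cong (⟦ t ⟧ α ℚ.+_) (sum-++ ts α))

nonNeg-⋆ : ∀ n {f} → NonNegSum f → NonNegSum (n ⋆ f)
nonNeg-⋆ zero    {f} p = nonNeg-cong (0⋆ f) nonNeg-0
nonNeg-⋆ (suc n) {f} p = nonNeg-cong (⋆-suc n f) (nonNeg-+ p (nonNeg-⋆ n p))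

-- The index is a successor because parts of a partition are positive; `e 0` is treated as the empty
-- product instead.
nonNeg-e* : ∀ i {f} → NonNegSum f → NonNegSum (e (suc i) *ˢ f)
nonNeg-e* i (ts , ps , p) = map times ts , All.map⁺ (All.map (λ (q , r) → q , s≤s z≤n ∷ r) ps) ,
  λ α → trans (*ˢ-congˡ (e (suc i)) p α) (distribute ts α)
  where
  times : Term → Term
  times (c , λs) = c , suc i ∷ λs
  distribute : ∀ ts → e (suc i) *ˢ sumˢ ts ⟦_⟧ ≈ˢ sumˢ (map times ts) ⟦_⟧
  distribute []              α = *ˢ-zeroʳ (e (suc i)) α
  distribute ((c , λs) ∷ ts) α = trans (*ˢ-distribˡ (e (suc i)) ⟦ c , λs ⟧ (sumˢ ts ⟦_⟧) α)
    (cong₂ ℚ._+_ (*ˢ-•ˢ c (e (suc i)) e[ λs ] α) (distribute ts α))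

nonNeg-e : ∀ i → NonNegSum (e i)
nonNeg-e zero    = nonNeg-cong e-0 nonNeg-1
nonNeg-e (suc i) = nonNeg-cong
  (λ α → sym (trans (*ˢ-comm (e (suc i)) 1ˢ α) (*ˢ-identityˡ (e (suc i)) α))) (nonNeg-e* i nonNeg-1)

nonNeg-*⋆e : ∀ n i {f} → NonNegSum f → NonNegSum (f *ˢ (n ⋆ e (suc i)))
nonNeg-*⋆e n i {f} p = nonNeg-cong
  (λ α → trans (*ˢ-•ˢ (+ n / 1) f (e (suc i)) α) (•ˢ-cong (+ n / 1) (*ˢ-comm f (e (suc i))) α))
  (nonNeg-⋆ n (nonNeg-e* i p))

nonNeg-sum : ∀ {A : Set} (xs : List A) {F : A → Series} → (∀ x → NonNegSum (F x)) → NonNegSum (sumˢ xs F)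
nonNeg-sum []       p = nonNeg-0
nonNeg-sum (x ∷ xs) p = nonNeg-+ (p x) (nonNeg-sum xs p)

-- In the recurrence `G i` vanishes for i < 2, so the paths that actually occur on the right are
-- shorter.
nonNeg-path : ∀ n → NonNegSum (X (path n))
nonNeg-path = <-rec _ λ n rec → nonNeg-cong (≈[]⇒≈ˢ λ k → InVariables.𝒳-P-≋ k n)
  (nonNeg-+ (nonNeg-e n) (nonNeg-sum (upTo (suc n)) (summand n rec)))
  where
  summand : ∀ n → (∀ {m} → m ℕ.< n → NonNegSum (X (path m))) → ∀ i → NonNegSum (G i *ˢ X (path (n ∸ i)))
  summand n       rec 0             = nonNeg-cong (*ˢ-zeroˡ (X (path n))) nonNeg-0
  summand n       rec 1             = nonNeg-cong (*ˢ-zeroˡ (X (path (n ∸ 1)))) nonNeg-0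
  -- Such an index lies outside `upTo 1`, but `nonNeg-sum` asks for every index. Truncated
  -- subtraction then yields the empty path, which is no shorter, so its value 1 is used instead of
  -- the induction hypothesis.
  summand zero    rec (suc (suc i)) = nonNeg-cong (*ˢ-comm (suc i ⋆ e (suc (suc i))) (X (path 0)))
    (nonNeg-*⋆e (suc i) (suc i) (nonNeg-cong (≈[]⇒≈ˢ InVariables.X-path-0) nonNeg-1))
  summand (suc n) rec (suc (suc i)) = nonNeg-cong (*ˢ-comm (suc i ⋆ e (suc (suc i))) (X (path (n ∸ suc i))))
    (nonNeg-*⋆e (suc i) (suc i) (rec (s≤s (ℕ.m∸n≤m n (suc i)))))

nonNeg-𝒴 : ∀ n → NonNegSum (𝒴 n)
nonNeg-𝒴 n = nonNeg-+ (nonNeg-sum (upTo (suc n)) λ i → summand (nonNeg-path i) (n ∸ i)) (tail n)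
  where
  summand : ∀ {f} → NonNegSum f → ∀ j → NonNegSum (f *ˢ G≥ 3 j)
  summand {f} p 0                   = nonNeg-cong (*ˢ-zeroʳ f) nonNeg-0
  summand {f} p 1                   = nonNeg-cong (*ˢ-zeroʳ f) nonNeg-0
  summand {f} p 2                   = nonNeg-cong (*ˢ-zeroʳ f) nonNeg-0
  summand {f} p (suc (suc (suc j))) = nonNeg-*⋆e (suc (suc j)) (suc (suc j)) p
  tail : ∀ n → NonNegSum (∑≥ 2 e n)
  tail 0             = nonNeg-0
  tail 1             = nonNeg-0
  tail (suc (suc n)) = nonNeg-e (suc (suc n))

-- Twinning at a chosen end vertex

module _ (v : (n : ℕ) .{{_ : NonZero n}} → Fin n) (v-end : (n : ℕ) .{{_ : NonZero n}} → IsEndVertex (v n)) where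

  X-twin-double : ∀ m → X (twin (path (suc m)) (v (suc m))) ≈ˢ 𝒴 (suc (suc m)) +ˢ 𝒴 (suc (suc m))
  X-twin-double m α = trans (X-twin-end (v (suc m)) (v-end (suc m)) α)
    (≈[]⇒≈ˢ (λ k → InVariables.X-twin-double k m) α)

  X-twin≈2⋆ : ∀ m f → 𝒴 (suc (suc m)) ≈ˢ f → X (twin (path (suc m)) (v (suc m))) ≈ˢ 2 ⋆ f
  X-twin≈2⋆ m f p α = trans (X-twin-double m α) (trans (cong₂ ℚ._+_ (p α) (p α)) (sym (2⋆ f α)))

  half-𝒳-Pᵥ : ½ •ᶻ 𝒳-Pᵥ v ≈ᶻ 𝒴
  half-𝒳-Pᵥ 0             α = trans (ℚ.*-zeroʳ ½) (sym (≈[]⇒≈ˢ InVariables.𝒴-0 α))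
  half-𝒳-Pᵥ 1             α = trans (ℚ.*-zeroʳ ½) (sym (≈[]⇒≈ˢ InVariables.𝒴-1 α))
  half-𝒳-Pᵥ (suc (suc m)) α = trans (•ˢ-cong ½ (X-twin-double m) α) (½•-double (𝒴 (suc (suc m))) α)

  twin-ePositive : (n : ℕ) .{{_ : NonZero n}} → EPositive (X (twin (path n) (v n)))
  -- The impossible instance is irrelevant, so it is consumed by `v zero`, an element of the empty
  -- `Fin 0`.
  twin-ePositive zero    = contradiction (v zero) Fin.¬Fin0
  twin-ePositive (suc m) = NonNegSum⇒EPositive (nonNeg-cong
    {X (twin (path (suc m)) (v (suc m)))} {2 ⋆ 𝒴 (suc (suc m))}
    (X-twin≈2⋆ m (𝒴 (suc (suc m))) λ α → refl) (nonNeg-⋆ 2 {𝒴 (suc (suc m))} (nonNeg-𝒴 (suc (suc m)))))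

proposition3p9 : (v : (n : ℕ) .{{_ : NonZero n}} → Fin n) →
    ((n : ℕ) .{{_ : NonZero n}} → IsEndVertex (v n)) →
    (½ •ᶻ 𝒳-Pᵥ v ≈ᶻ
    K *ᶻ (G≥ 3 /ᶻ D) +ᶻ (e 1 z^ 1) *ᶻ G *ᶻ (G≥ 3 /ᶻ D) +ᶻ e 2 z^ 2
    +ᶻ ∑≥ 3 (λ i → i ⋆ e i) +ᶻ (e 1 z^ 1) *ᶻ G≥ 3)
    × ((n : ℕ) .{{_ : NonZero n}} → EPositive (X (twin (path n) (v n))))
    × (X (twin (path 1) (v 1)) ≈ˢ 2 ⋆ e 2)
    × (X (twin (path 2) (v 2)) ≈ˢ 2 ⋆ (3 ⋆ e 3))
    × (X (twin (path 3) (v 3)) ≈ˢ 2 ⋆ (4 ⋆ e 4 +ˢ 2 ⋆ (e 1 *ˢ e 3)))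
    × (X (twin (path 4) (v 4)) ≈ˢ 2 ⋆ (4 ⋆ (e 2 *ˢ e 3) +ˢ 3 ⋆ (e 1 *ˢ e 4) +ˢ 5 ⋆ e 5))
    × (½ •ᶻ 𝒳-Pᵥ v ≈ᶻ 𝒳-P *ᶻ G≥ 3 +ᶻ ∑≥ 2 e)
    × EPositiveᶻ (𝒳-P *ᶻ G≥ 3 +ᶻ ∑≥ 2 e)
proposition3p9 v v-end =
  (λ n α → trans (half-𝒳-Pᵥ v v-end n α) (≈[]⇒≈ˢ (λ k → InVariables.𝒴-quotientForm k n) α))
  , twin-ePositive v v-end
  , X-twin≈2⋆ v v-end 0 (e 2) (≈[]⇒≈ˢ InVariables.𝒴-2)
  , X-twin≈2⋆ v v-end 1 (3 ⋆ e 3) (≈[]⇒≈ˢ InVariables.𝒴-3)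
  , X-twin≈2⋆ v v-end 2 (4 ⋆ e 4 +ˢ 2 ⋆ (e 1 *ˢ e 3)) (≈[]⇒≈ˢ InVariables.𝒴-4)
  , X-twin≈2⋆ v v-end 3 (4 ⋆ (e 2 *ˢ e 3) +ˢ 3 ⋆ (e 1 *ˢ e 4) +ˢ 5 ⋆ e 5) (≈[]⇒≈ˢ InVariables.𝒴-5)
  , half-𝒳-Pᵥ v v-end
  , (λ n → NonNegSum⇒EPositive (nonNeg-𝒴 n))
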